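{- Let $T(n)$ denote the number of polyiamonds consisting of exactly $n$ triangles, counted up to translation, and let $\lambda_T=\lim_{n\to\infty}\frac{T(n+1)}{T(n)}$ be the growth constant of polyiamonds. Let $z$ be the unique real root of the equation $2z^3+z^2-1=0$. Then $$\lambda_T\le 1+2z+3z^2 .$$
   Context: The triangular lattice is the regular tiling of the Euclidean plane by congruent equilateral triangles (each triangle of the tiling has one of two orientations, pointing left or pointing right). Two triangles of the tiling are adjacent if they share an edge. A polyiamond is a finite nonempty set of triangles of this tiling that is edge-connected, i.e. the graph on the set whose edges are the pairs of adjacent triangles is connected. Two polyiamonds are considered the same, and counted once, if one is a translate of the other (rotations and reflections are not identified). For $n\ge 1$, $T(n)$ is the number of polyiamonds with exactly $n$ triangles under this identification; for example $T(1)=2$ and $T(3)=6$. It is a known fact from earlier literature that the limit $\lambda_T=\lim_{n\to\infty} T(n+1)/T(n)$ exists; it also satisfies $\lambda_T=\lim_{n\to\infty}\sqrt[n]{T(n)}=\sup_n\sqrt[n]{T(n)}$ (where the supremum formula uses the known supermultiplicativity $T(\ell+m)\ge T(\ell)T(m)$ for all $\ell,m\ge1$ not both equal to $1$). -}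

module Defs where

open import Data.Nat.Base as ℕ using (ℕ; zero; suc)
import Data.Nat.Properties as ℕP
open import Data.Integer.Base as ℤ using (ℤ; +_; 0ℤ; 1ℤ)
import Data.Integer.Properties as ℤP
open import Data.Rational.Base as ℚ using (ℚ; 0ℚ; 1ℚ; ½)
import Data.Rational.Properties as ℚP
open import Data.Rational.Solver using (module +-*-Solver)
open import Data.Fin.Base using (Fin)
open import Data.List.Base using (List; []; _∷_; length; map)
open import Data.List.Properties using (map-∘; map-cong; map-id)
open import Data.List.Membership.Propositional using (_∈_)
open import Data.List.Relation.Binary.BagAndSetEquality as BagAndSet using (_∼[_]_; set; [_]-Equality)
open import Data.List.Relation.Unary.Unique.Propositional using (Unique)
open import Data.Product.Base using (∃; _×_; _,_)
open import Data.Sum.Base using (inj₁; inj₂)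
open import Function.Bundles using (Bijection)
open import Function.Related.Propositional using (SymmetricKind)
open import Level using (Level; 0ℓ)
open import Relation.Binary.Bundles using (Setoid)
open import Relation.Binary.Construct.Closure.ReflexiveTransitive using (Star)
open import Relation.Binary.PropositionalEquality

-- The triangular lattice.  Lattice points have integer coordinates with
-- respect to two unit vectors u, v at an angle of 60°; the difference u − v
-- is taken to be vertical.

Vector : Set
Vector = ℤ × ℤ

infixl 6 _⊕_
_⊕_ : Vector → Vector → Vector
(a , b) ⊕ (c , d) = a ℤ.+ c , b ℤ.+ d

u v : Vector
u = 1ℤ , 0ℤ
v = 0ℤ , 1ℤ

data Orientation : Set where
  left right : Orientation

-- The rhombus P, P + u, P + u + v, P + v is cut by its diagonal from P + u to
-- P + v: (left , P) is the triangle P, P + u, P + v (apex P on the left) and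
-- (right , P) is the triangle P + u, P + v, P + u + v (apex on the right).

Triangle : Set
Triangle = Orientation × Vector

Edge : Set
Edge = Vector × Vector

-- An edge is listed by its endpoints in the order (Q , Q + u), (Q , Q + v) or
-- (P + u , P + v), so two edges are the same segment iff they are equal.
edges : Triangle → List Edge
edges (left  , p) = (p , p ⊕ u) ∷ (p , p ⊕ v) ∷ (p ⊕ u , p ⊕ v) ∷ []
edges (right , p) = (p ⊕ v , p ⊕ v ⊕ u) ∷ (p ⊕ u , p ⊕ u ⊕ v) ∷ (p ⊕ u , p ⊕ v) ∷ []

Adjacent : Triangle → Triangle → Set
Adjacent s t = s ≢ t × ∃ λ e → e ∈ edges s × e ∈ edges t

Connected : List Triangle → Set
Connected ts = ∀ {s t} → s ∈ ts → t ∈ ts →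
  Star (λ a b → a ∈ ts × b ∈ ts × Adjacent a b) s t

translate : Vector → Triangle → Triangle
translate w (o , p) = o , p ⊕ w

record Polyiamond (n : ℕ) : Set where
  field
    cells     : List Triangle
    distinct  : Unique cells
    size      : length cells ≡ n
    nonempty  : cells ≢ []
    connected : Connected cells

open Polyiamond public

_IsTranslateOf_ : ∀ {n} → Polyiamond n → Polyiamond n → Set
Q IsTranslateOf P = ∃ λ w → map (translate w) (cells P) ∼[ set ] cells Q

private
  module SetEq = Setoid ([ SymmetricKind.equivalence ]-Equality Triangle)

  neg : Vector → Vector
  neg (a , b) = ℤ.- a , ℤ.- b

  translate-zero : ∀ t → translate (0ℤ , 0ℤ) t ≡ t
  translate-zero (o , (a , b)) =
    cong₂ (λ x y → o , (x , y)) (ℤP.+-identityʳ a) (ℤP.+-identityʳ b)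

  translate-⊕ : ∀ w w′ t → translate w′ (translate w t) ≡ translate (w ⊕ w′) t
  translate-⊕ (c , d) (c′ , d′) (o , (a , b)) =
    cong₂ (λ x y → o , (x , y)) (ℤP.+-assoc a c c′) (ℤP.+-assoc b d d′)

  ⊕-neg : ∀ w → w ⊕ neg w ≡ (0ℤ , 0ℤ)
  ⊕-neg (a , b) = cong₂ _,_ (ℤP.+-inverseʳ a) (ℤP.+-inverseʳ b)

  map-translate-zero : ∀ ts → map (translate (0ℤ , 0ℤ)) ts ≡ ts
  map-translate-zero ts = trans (map-cong translate-zero ts) (map-id ts)

  map-translate-⊕ : ∀ w w′ ts →
    map (translate w′) (map (translate w) ts) ≡ map (translate (w ⊕ w′)) ts
  map-translate-⊕ w w′ ts = trans (sym (map-∘ ts)) (map-cong (translate-⊕ w w′) ts)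

  map-translate-neg : ∀ w ts → map (translate (neg w)) (map (translate w) ts) ≡ ts
  map-translate-neg w ts = trans (map-translate-⊕ w (neg w) ts)
    (trans (cong (λ x → map (translate x) ts) (⊕-neg w)) (map-translate-zero ts))

  map-set : ∀ w {ts ts′} → ts ∼[ set ] ts′ → map (translate w) ts ∼[ set ] map (translate w) ts′
  map-set w eq = BagAndSet.map-cong (λ _ → refl) eq

Polyiamonds : ℕ → Setoid 0ℓ 0ℓ
Polyiamonds n = record
  { Carrier       = Polyiamond n
  ; _≈_           = λ P Q → Q IsTranslateOf P
  ; isEquivalence = record
    { refl  = λ {P} → (0ℤ , 0ℤ) , SetEq.reflexive (map-translate-zero (cells P))
    ; sym   = λ { {P} {Q} (w , eq) → neg w ,
        SetEq.trans (SetEq.sym (map-set (neg w) eq))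
                    (SetEq.reflexive (map-translate-neg w (cells P))) }
    ; trans = λ { {P} {Q} {R} (w , eq) (w′ , eq′) → w ⊕ w′ ,
        SetEq.trans (SetEq.reflexive (sym (map-translate-⊕ w w′ (cells P))))
                    (SetEq.trans (map-set w′ eq) eq′) }
    }
  }

HasCardinality : ∀ {a ℓ : Level} → Setoid a ℓ → ℕ → Set _
HasCardinality S k = Bijection (setoid (Fin k)) S

-- The real numbers as Cauchy sequences of rationals, with the operations
-- taken termwise and equality and order defined up to null sequences.

Eventually : (ℕ → Set) → Set
Eventually P = ∃ λ N → ∀ n → N ℕ.≤ n → P n

IsCauchy : (ℕ → ℚ) → Set
IsCauchy x = ∀ ε → 0ℚ ℚ.< ε →
  ∃ λ N → ∀ m n → N ℕ.≤ m → N ℕ.≤ n → ℚ.∣ x m ℚ.- x n ∣ ℚ.< ε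

record ℝ : Set where
  constructor mkℝ
  field
    seq    : ℕ → ℚ
    cauchy : IsCauchy seq

open ℝ public

private
  module CauchyLemmas where
    open import Data.Rational.Base
    open import Data.Rational.Properties
    open +-*-Solver

    const-cauchy : ∀ q → IsCauchy (λ _ → q)
    const-cauchy q ε 0<ε = 0 , λ _ _ _ _ →
      subst (λ r → ∣ r ∣ < ε) (sym (+-inverseʳ q)) 0<ε

    half-pos : ∀ {ε} → 0ℚ < ε → 0ℚ < ½ * ε
    half-pos {ε} 0<ε = subst (_< ½ * ε) (*-zeroʳ ½) (*-monoʳ-<-pos ½ 0<ε)

    two-halves : ∀ ε → ½ * ε + ½ * ε ≡ ε
    two-halves ε = trans (sym (*-distribʳ-+ ε ½ ½)) (*-identityˡ ε)

    +-cauchy : ∀ {x y} → IsCauchy x → IsCauchy y → IsCauchy (λ n → x n + y n)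
    +-cauchy {x} {y} cx cy ε 0<ε with cx (½ * ε) (half-pos 0<ε) | cy (½ * ε) (half-pos 0<ε)
    ... | N , p | M , q = N ℕ.⊔ M , λ m n m≥ n≥ → begin-strict
      ∣ (x m + y m) - (x n + y n) ∣
        ≡⟨ cong ∣_∣ (solve 4 (λ a b c d → (a :+ b) :- (c :+ d) := (a :- c) :+ (b :- d)) refl (x m) (y m) (x n) (y n)) ⟩
      ∣ (x m - x n) + (y m - y n) ∣
        ≤⟨ ∣p+q∣≤∣p∣+∣q∣ (x m - x n) (y m - y n) ⟩
      ∣ x m - x n ∣ + ∣ y m - y n ∣
        <⟨ +-mono-< (p m n (ℕP.m⊔n≤o⇒m≤o N M m≥) (ℕP.m⊔n≤o⇒m≤o N M n≥))
                    (q m n (ℕP.m⊔n≤o⇒n≤o N M m≥) (ℕP.m⊔n≤o⇒n≤o N M n≥)) ⟩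
      ½ * ε + ½ * ε
        ≡⟨ two-halves ε ⟩
      ε ∎
      where open ≤-Reasoning

    neg-cauchy : ∀ {x} → IsCauchy x → IsCauchy (λ n → - x n)
    neg-cauchy {x} cx ε 0<ε with cx ε 0<ε
    ... | N , p = N , λ m n m≥ n≥ → subst (_< ε)
      (trans (sym (∣-p∣≡∣p∣ (x m - x n)))
        (cong ∣_∣ (solve 2 (λ a b → :- (a :- b) := (:- a) :- (:- b)) refl (x m) (x n))))
      (p m n m≥ n≥)

    ∣p∣≤∣p-q∣+∣q∣ : ∀ p q → ∣ p ∣ ≤ ∣ p - q ∣ + ∣ q ∣
    ∣p∣≤∣p-q∣+∣q∣ p q = subst (λ r → ∣ r ∣ ≤ ∣ p - q ∣ + ∣ q ∣)
      (solve 2 (λ a b → (a :- b) :+ b := a) refl p q) (∣p+q∣≤∣p∣+∣q∣ (p - q) q)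

    ∣p∣-∣q∣≤∣p-q∣ : ∀ p q → ∣ p ∣ - ∣ q ∣ ≤ ∣ p - q ∣
    ∣p∣-∣q∣≤∣p-q∣ p q = subst (∣ p ∣ - ∣ q ∣ ≤_)
      (solve 2 (λ a b → (a :+ b) :- b := a) refl ∣ p - q ∣ ∣ q ∣)
      (+-monoˡ-≤ (- ∣ q ∣) (∣p∣≤∣p-q∣+∣q∣ p q))

    ∣∣p∣-∣q∣∣≤∣p-q∣ : ∀ p q → ∣ ∣ p ∣ - ∣ q ∣ ∣ ≤ ∣ p - q ∣
    ∣∣p∣-∣q∣∣≤∣p-q∣ p q with ∣p∣≡p∨∣p∣≡-p (∣ p ∣ - ∣ q ∣)
    ... | inj₁ eq = subst (_≤ ∣ p - q ∣) (sym eq) (∣p∣-∣q∣≤∣p-q∣ p q)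
    ... | inj₂ eq = subst₂ _≤_
      (trans (solve 2 (λ a b → b :- a := :- (a :- b)) refl ∣ p ∣ ∣ q ∣) (sym eq))
      (trans (sym (∣-p∣≡∣p∣ (q - p)))
        (cong ∣_∣ (solve 2 (λ a b → :- (b :- a) := a :- b) refl p q)))
      (∣p∣-∣q∣≤∣p-q∣ q p)

    abs-cauchy : ∀ {x} → IsCauchy x → IsCauchy (λ n → ∣ x n ∣)
    abs-cauchy {x} cx ε 0<ε with cx ε 0<ε
    ... | N , p = N , λ m n m≥ n≥ →
      ≤-<-trans (∣∣p∣-∣q∣∣≤∣p-q∣ (x m) (x n)) (p m n m≥ n≥)

    eventually-bounded : ∀ {x} → IsCauchy x →
      ∃ λ B → 0ℚ < B × Eventually (λ n → ∣ x n ∣ ≤ B)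
    eventually-bounded {x} cx with cx 1ℚ (positive⁻¹ 1ℚ)
    ... | N , p = 1ℚ + ∣ x N ∣ , +-mono-<-≤ (positive⁻¹ 1ℚ) (0≤∣p∣ (x N)) , N , λ n n≥ →
      ≤-trans (∣p∣≤∣p-q∣+∣q∣ (x n) (x N))
              (+-monoˡ-≤ ∣ x N ∣ (<⇒≤ (p n N n≥ ℕP.≤-refl)))

    *-bound : ∀ {a b B δ} → 0ℚ < B → ∣ a ∣ ≤ B → ∣ b ∣ < δ → ∣ a * b ∣ < B * δ
    *-bound {a} {b} {B} {δ} 0<B a≤B b<δ = begin-strict
      ∣ a * b ∣      ≡⟨ ∣p*q∣≡∣p∣*∣q∣ a b ⟩
      ∣ a ∣ * ∣ b ∣  ≤⟨ *-monoʳ-≤-nonNeg ∣ b ∣ {{∣-∣-nonNeg b}} a≤B ⟩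
      B * ∣ b ∣      <⟨ *-monoʳ-<-pos B {{positive 0<B}} b<δ ⟩
      B * δ          ∎
      where open ≤-Reasoning

    divide : ∀ C ε → 0ℚ < C → 0ℚ < ε → ∃ λ δ → 0ℚ < δ × C * δ ≡ ε
    divide C ε 0<C 0<ε = C⁻¹ * ε ,
      positive⁻¹ (C⁻¹ * ε) {{pos*pos⇒pos C⁻¹ {{1/pos⇒pos C {{pos-C}}}} ε {{positive 0<ε}}}} ,
      trans (sym (*-assoc C C⁻¹ ε))
        (trans (cong (_* ε) (*-inverseʳ C {{pos⇒nonZero C {{pos-C}}}})) (*-identityˡ ε))
      where
      pos-C : Positive C
      pos-C = positive 0<C
      C⁻¹ : ℚ
      C⁻¹ = (1/ C) {{pos⇒nonZero C {{pos-C}}}}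

    *-difference : ∀ a b c d → a * b - c * d ≡ a * (b - d) + d * (a - c)
    *-difference = solve 4 (λ a b c d → a :* b :- c :* d := a :* (b :- d) :+ d :* (a :- c)) refl

    *-estimate : ∀ {a b c d A B δ} → 0ℚ < A → 0ℚ < B → ∣ a ∣ ≤ A → ∣ d ∣ ≤ B →
      ∣ a - c ∣ < δ → ∣ b - d ∣ < δ → ∣ a * b - c * d ∣ < (A + B) * δ
    *-estimate {a} {b} {c} {d} {A} {B} {δ} 0<A 0<B a≤A d≤B ac<δ bd<δ = begin-strict
      ∣ a * b - c * d ∣                    ≡⟨ cong ∣_∣ (*-difference a b c d) ⟩
      ∣ a * (b - d) + d * (a - c) ∣        ≤⟨ ∣p+q∣≤∣p∣+∣q∣ (a * (b - d)) (d * (a - c)) ⟩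
      ∣ a * (b - d) ∣ + ∣ d * (a - c) ∣    <⟨ +-mono-< (*-bound {a} {b - d} 0<A a≤A bd<δ) (*-bound {d} {a - c} 0<B d≤B ac<δ) ⟩
      A * δ + B * δ                        ≡⟨ sym (*-distribʳ-+ δ A B) ⟩
      (A + B) * δ                          ∎
      where open ≤-Reasoning

    *-cauchy : ∀ {x y} → IsCauchy x → IsCauchy y → IsCauchy (λ n → x n * y n)
    *-cauchy {x} {y} cx cy ε 0<ε =
      let A , 0<A , N₁ , x≤A = eventually-bounded {x} cx
          B , 0<B , N₂ , y≤B = eventually-bounded {y} cy
          δ , 0<δ , Cδ≡ε     = divide (A + B) ε (+-mono-< 0<A 0<B) 0<ε
          N₃ , p             = cx δ 0<δ
          N₄ , q             = cy δ 0<δ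
          N                  = (N₁ ℕ.⊔ N₂) ℕ.⊔ (N₃ ℕ.⊔ N₄)
          ≥N₁₂ : ∀ {n} → N ℕ.≤ n → N₁ ℕ.⊔ N₂ ℕ.≤ n
          ≥N₁₂ = ℕP.m⊔n≤o⇒m≤o (N₁ ℕ.⊔ N₂) (N₃ ℕ.⊔ N₄)
          ≥N₃₄ : ∀ {n} → N ℕ.≤ n → N₃ ℕ.⊔ N₄ ℕ.≤ n
          ≥N₃₄ = ℕP.m⊔n≤o⇒n≤o (N₁ ℕ.⊔ N₂) (N₃ ℕ.⊔ N₄)
      in N , λ m n m≥ n≥ → subst (∣ x m * y m - x n * y n ∣ <_) Cδ≡ε
        (*-estimate {x m} {y m} {x n} {y n} 0<A 0<B
          (x≤A m (ℕP.m⊔n≤o⇒m≤o N₁ N₂ (≥N₁₂ m≥)))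
          (y≤B n (ℕP.m⊔n≤o⇒n≤o N₁ N₂ (≥N₁₂ n≥)))
          (p m n (ℕP.m⊔n≤o⇒m≤o N₃ N₄ (≥N₃₄ m≥)) (ℕP.m⊔n≤o⇒m≤o N₃ N₄ (≥N₃₄ n≥)))
          (q m n (ℕP.m⊔n≤o⇒n≤o N₃ N₄ (≥N₃₄ m≥)) (ℕP.m⊔n≤o⇒n≤o N₃ N₄ (≥N₃₄ n≥))))

open CauchyLemmas

fromℚ : ℚ → ℝ
fromℚ q = mkℝ (λ _ → q) (const-cauchy q)

fromℕ : ℕ → ℝ
fromℕ n = fromℚ (+ n ℚ./ 1)

infixl 6 _+_ _-_
infixl 7 _*_
infixr 8 _^_
infix  8 -_
infix  4 _≃_ _<_ _≤_

_+_ : ℝ → ℝ → ℝ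
x + y = mkℝ (λ n → seq x n ℚ.+ seq y n) (+-cauchy {seq x} {seq y} (cauchy x) (cauchy y))

-_ : ℝ → ℝ
- x = mkℝ (λ n → ℚ.- seq x n) (neg-cauchy {seq x} (cauchy x))

_-_ : ℝ → ℝ → ℝ
x - y = x + (- y)

_*_ : ℝ → ℝ → ℝ
x * y = mkℝ (λ n → seq x n ℚ.* seq y n) (*-cauchy {seq x} {seq y} (cauchy x) (cauchy y))

_^_ : ℝ → ℕ → ℝ
x ^ zero  = fromℕ 1
x ^ suc n = x * x ^ n

∣_∣ : ℝ → ℝ
∣ x ∣ = mkℝ (λ n → ℚ.∣ seq x n ∣) (abs-cauchy {seq x} (cauchy x))

_≃_ : ℝ → ℝ → Set
x ≃ y = ∀ ε → 0ℚ ℚ.< ε → Eventually λ n → ℚ.∣ seq x n ℚ.- seq y n ∣ ℚ.< ε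

_<_ : ℝ → ℝ → Set
x < y = ∃ λ δ → 0ℚ ℚ.< δ × Eventually λ n → seq x n ℚ.+ δ ℚ.< seq y n

_≤_ : ℝ → ℝ → Set
x ≤ y = ∀ ε → 0ℚ ℚ.< ε → Eventually λ n → seq x n ℚ.< seq y n ℚ.+ ε

-- Rational ε suffice, since every positive real exceeds a positive rational.
ConvergesTo : (ℕ → ℝ) → ℝ → Set
ConvergesTo a L = ∀ ε → 0ℚ ℚ.< ε → Eventually λ n → ∣ a n - L ∣ < fromℚ ε

-- Division by zero is given the value 0; a count T n with n ≥ 1 is never zero.
quotient : ℕ → ℕ → ℚ
quotient a zero    = 0ℚ
quotient a (suc b) = + a ℚ./ suc b

{-# OPTIONS --safe #-}
module Submission where

open import Defs
open import Data.Nat.Base as ℕ using (ℕ; zero; suc)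
open import Algebra.Bundles using (CommutativeRing)
import Data.Nat.Properties as ℕP
open import Data.Nat.Solver using () renaming (module +-*-Solver to ℕSolver)
open import Data.Integer.Base as ℤ using (0ℤ; 1ℤ; -1ℤ; +_; -[1+_])
import Data.Integer.Properties as ℤP
open import Data.Integer.Tactic.RingSolver using (solve-∀)
open import Data.Rational.Base as ℚ using (ℚ; 0ℚ; 1ℚ; ½; mkℚ; toℚᵘ)
import Data.Rational.Properties as ℚP
open import Data.Rational.Solver using () renaming (module +-*-Solver to ℚSolver)
open import Data.Rational.Unnormalised.Base as ℚᵘ using (mkℚᵘ; *≡*; *<*)
import Data.Rational.Unnormalised.Properties as ℚᵘP
open import Algebra.Properties.Semiring.Exp (CommutativeRing.semiring ℚP.+-*-commutativeRing) using (^-homo-*) renaming (_^_ to _^ᵠ_)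
open import Data.Fin.Base using (Fin; zero; suc; toℕ)
open import Data.List.Base using (List; []; _∷_; _++_; length; map; tabulate; allFin; cartesianProductWith)
open import Data.List.Properties using (map-++; map-∘; length-++; length-tabulate)
open import Data.List.Membership.Propositional using (_∈_)
open import Data.List.Membership.Propositional.Properties using (∈-∃++; ∈-++⁺ˡ; ∈-++⁺ʳ; ∈-++⁻; ∈-map⁺; ∈-map⁻; ∈-cartesianProductWith⁺; ∈-allFin)
import Data.List.Membership.DecPropositional as DecMembership
open import Data.List.Relation.Binary.BagAndSetEquality as BagAndSet using (_∼[_]_; set)
open import Data.List.Relation.Binary.Permutation.Propositional as Perm using (_↭_; ↭-refl; ↭-trans; prep)
open import Data.List.Relation.Binary.Permutation.Propositional.Properties using (∈-resp-↭; ↭-length; shift)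
open import Data.List.Relation.Binary.Subset.Propositional using (_⊆_)
open import Data.List.Relation.Unary.All as All using (All; []; _∷_)
open import Data.List.Relation.Unary.All.Properties as AllP using (++⁺; ++⁻ˡ; ++⁻ʳ)
open import Data.List.Relation.Unary.AllPairs using ([]; _∷_)
open import Data.List.Relation.Unary.Any using (here; there)
open import Data.List.Relation.Unary.Unique.Propositional using (Unique)
import Data.List.Relation.Unary.Unique.Propositional.Properties as UniqueP
open import Data.Product.Base using (∃; _×_; _,_; proj₁; proj₂)
open import Data.Product.Properties using (≡-dec)
open import Data.Sum.Base using (_⊎_; inj₁; inj₂)
open import Data.Vec.Base as Vec using (Vec; []; _∷_)
open import Data.Vec.Properties using (++-injective)
open import Function.Base using (_∘_)
open import Function.Bundles using (Bijection; mk⇔)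
open import Function.Related.Propositional using (SymmetricKind)
open import Relation.Binary.Bundles using (Setoid)
open import Relation.Binary.Construct.Closure.ReflexiveTransitive using (Star; _◅_) renaming (ε to stop)
open import Relation.Binary.PropositionalEquality
open import Relation.Nullary using (Dec; yes; no; ¬_; contradiction)
open import Relation.Nullary.Decidable using (decidable-stable)
open import Relation.Unary using (Decidable)

-- Every edge of the tiling is of one of three types, and crossing them gives
-- three involutions of the set of triangles.  A polyiamond is explored from
-- the six triangles around a lattice point.  A visited triangle t remembers
-- which of its sides leads to the preceding triangle, which to the following
-- one and which points outwards; when t is processed, one turns around the
-- common endpoint of the preceding and the outward side, starting with the
-- outward neighbour, and visits triangles as long as they are new cells of the
-- polyiamond.  Of the six triangles around that point, t and the two that
-- precede it are taken care of elsewhere, so at most three are visited, and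
-- one digit 0, 1, 2 or 3 per cell determines the polyiamond.  The digits of an
-- n-celled polyiamond have sum at most n + O(1), whence
-- T(n) qⁿ ≤ C (1 + q + q² + q³)ⁿ for all rational q in [0, 1], and therefore
-- λ ≤ (1 + q + q² + q³) / q.  The right-hand side has derivative
-- (2q³ + q² − 1) / q², and its minimum, at q = z, is 1 + 2z + 3z².

-- Lists without repetitions

-- The complement `zs` makes sums over `ys` split, which serves both for comparing lengths and for
-- comparing weights.
unique⊆⇒↭ : ∀ {A : Set} {xs ys : List A} → Unique xs → xs ⊆ ys → ∃ λ zs → ys ↭ xs ++ zs
unique⊆⇒↭ {ys = ys} [] _ = ys , ↭-refl
unique⊆⇒↭ {xs = x ∷ xs} (x∉xs ∷ distinct) xs⊆ys with ∈-∃++ (xs⊆ys (here refl))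
... | as , bs , refl = zs , ↭-trans (shift x as bs) (prep x rest↭)
  where
  xs⊆rest : xs ⊆ as ++ bs
  xs⊆rest {y} y∈xs with ∈-resp-↭ (shift x as bs) (xs⊆ys (there y∈xs))
  ... | here y≡x = contradiction (sym y≡x) (All.lookup x∉xs y∈xs)
  ... | there y∈ = y∈
  zs = proj₁ (unique⊆⇒↭ distinct xs⊆rest)
  rest↭ = proj₂ (unique⊆⇒↭ distinct xs⊆rest)

unique⊆⇒length≤ : ∀ {A : Set} {xs ys : List A} → Unique xs → xs ⊆ ys → length xs ℕ.≤ length ys
unique⊆⇒length≤ {xs = xs} distinct xs⊆ys with unique⊆⇒↭ distinct xs⊆ys
... | zs , ys↭ rewrite ↭-length ys↭ | length-++ xs {zs} = ℕP.m≤m+n (length xs) (length zs)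

-- The triangular lattice

infixl 6 _⊖_
_⊖_ : Vector → Vector → Vector
(a , b) ⊖ (c , d) = a ℤ.- c , b ℤ.- d

_≟ᵒ_ : (o o′ : Orientation) → Dec (o ≡ o′)
left  ≟ᵒ left  = yes refl
left  ≟ᵒ right = no λ ()
right ≟ᵒ left  = no λ ()
right ≟ᵒ right = yes refl

open DecMembership (≡-dec _≟ᵒ_ (≡-dec ℤP._≟_ ℤP._≟_)) using (_∈?_)

data Side : Set where
  along-u along-v diagonal : Side

offset : Side → Vector
offset along-u  = v
offset along-v  = u
offset diagonal = 0ℤ , 0ℤ

cross : Side → Triangle → Triangle
cross d (left  , p) = right , p ⊖ offset d
cross d (right , p) = left  , p ⊕ offset d

cross-involutive : ∀ d t → cross d (cross d t) ≡ t
cross-involutive d (left , p) = cong₂ (λ x y → left , x , y)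
  (lemma (proj₁ p) (proj₁ (offset d)))
  (lemma (proj₂ p) (proj₂ (offset d)))
  where
  lemma : ∀ a b → a ℤ.- b ℤ.+ b ≡ a
  lemma = solve-∀
cross-involutive d (right , p) = cong₂ (λ x y → right , x , y)
  (lemma (proj₁ p) (proj₁ (offset d)))
  (lemma (proj₂ p) (proj₂ (offset d)))
  where
  lemma : ∀ a b → a ℤ.+ b ℤ.- b ≡ a
  lemma = solve-∀

-- For distinct sides this says that six triangles surround a lattice point; it
-- holds in general because crossing a side shifts the left triangles by a fixed
-- vector and the right ones by its negative.
cross-hexagon : ∀ a b c t →
  cross b (cross a (cross c (cross b (cross a t)))) ≡ cross c t
cross-hexagon a b c (left , p) = cong₂ (λ x y → right , x , y)
  (lemma (proj₁ p) (proj₁ (offset a)) (proj₁ (offset b)) (proj₁ (offset c)))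
  (lemma (proj₂ p) (proj₂ (offset a)) (proj₂ (offset b)) (proj₂ (offset c)))
  where
  lemma : ∀ p a b c → p ℤ.- a ℤ.+ b ℤ.- c ℤ.+ a ℤ.- b ≡ p ℤ.- c
  lemma = solve-∀
cross-hexagon a b c (right , p) = cong₂ (λ x y → left , x , y)
  (lemma (proj₁ p) (proj₁ (offset a)) (proj₁ (offset b)) (proj₁ (offset c)))
  (lemma (proj₂ p) (proj₂ (offset a)) (proj₂ (offset b)) (proj₂ (offset c)))
  where
  lemma : ∀ p a b c → p ℤ.+ a ℤ.- b ℤ.+ c ℤ.- a ℤ.+ b ≡ p ℤ.+ c
  lemma = solve-∀

cross-translate : ∀ w d t → cross d (translate w t) ≡ translate w (cross d t)
cross-translate w d (left , p) = cong₂ (λ x y → right , x , y)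
  (lemma (proj₁ p) (proj₁ w) (proj₁ (offset d)))
  (lemma (proj₂ p) (proj₂ w) (proj₂ (offset d)))
  where
  lemma : ∀ p w a → p ℤ.+ w ℤ.- a ≡ p ℤ.- a ℤ.+ w
  lemma = solve-∀
cross-translate w d (right , p) = cong₂ (λ x y → left , x , y)
  (lemma (proj₁ p) (proj₁ w) (proj₁ (offset d)))
  (lemma (proj₂ p) (proj₂ w) (proj₂ (offset d)))
  where
  lemma : ∀ p w a → p ℤ.+ w ℤ.+ a ≡ p ℤ.+ a ℤ.+ w
  lemma = solve-∀

-- Every edge of the tiling belongs to exactly one left triangle: `segment d p` is the side `d` of
-- `(left , p)`. Comparing edges thus reduces to comparing types and base points.
segment : Side → Vector → Edge
segment along-u  p = p , p ⊕ u
segment along-v  p = p , p ⊕ v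
segment diagonal p = p ⊕ u , p ⊕ v

⊕-identityʳ : ∀ p → p ⊕ (0ℤ , 0ℤ) ≡ p
⊕-identityʳ (a , b) = cong₂ _,_ (ℤP.+-identityʳ a) (ℤP.+-identityʳ b)

⊕-cancelʳ : ∀ p q w → p ⊕ w ≡ q ⊕ w → p ≡ q
⊕-cancelʳ (a , b) (c , d) (x , y) eq =
  cong₂ _,_ (∙-cancelʳ x a c (cong proj₁ eq)) (∙-cancelʳ y b d (cong proj₂ eq))
  where open import Algebra.Properties.AbelianGroup ℤP.+-0-abelianGroup using (∙-cancelʳ)

∈-edges-left : ∀ {e} p → e ∈ edges (left , p) → ∃ λ d → e ≡ segment d p
∈-edges-left p (here eq)                 = along-u , eq
∈-edges-left p (there (here eq))         = along-v , eq
∈-edges-left p (there (there (here eq))) = diagonal , eq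

∈-edges-right : ∀ {e} p → e ∈ edges (right , p) → ∃ λ d → e ≡ segment d (p ⊕ offset d)
∈-edges-right p (here eq)                 = along-u , eq
∈-edges-right p (there (here eq))         = along-v , eq
∈-edges-right p (there (there (here eq))) =
  diagonal , trans eq (cong (segment diagonal) (sym (⊕-identityʳ p)))

direction : Edge → Vector
direction (p , q) = q ⊖ p

sideVector : Side → Vector
sideVector along-u  = u
sideVector along-v  = v
sideVector diagonal = -1ℤ , 1ℤ

direction-segment : ∀ d p → direction (segment d p) ≡ sideVector d
direction-segment along-u  p = cong₂ _,_
  (lemma (proj₁ p) (proj₁ u))
  (lemma (proj₂ p) (proj₂ u))
  where
  lemma : ∀ a b → a ℤ.+ b ℤ.- a ≡ b
  lemma = solve-∀
direction-segment along-v  p = cong₂ _,_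
  (lemma (proj₁ p) (proj₁ v))
  (lemma (proj₂ p) (proj₂ v))
  where
  lemma : ∀ a b → a ℤ.+ b ℤ.- a ≡ b
  lemma = solve-∀
direction-segment diagonal p = cong₂ _,_
  (lemma (proj₁ p) (proj₁ u) (proj₁ v))
  (lemma (proj₂ p) (proj₂ u) (proj₂ v))
  where
  lemma : ∀ a b c → a ℤ.+ c ℤ.- (a ℤ.+ b) ≡ c ℤ.- b
  lemma = solve-∀

sideVector-injective : ∀ d d′ → sideVector d ≡ sideVector d′ → d ≡ d′
sideVector-injective along-u  along-u  _ = refl
sideVector-injective along-v  along-v  _ = refl
sideVector-injective diagonal diagonal _ = refl
sideVector-injective along-u  along-v  ()
sideVector-injective along-u  diagonal ()
sideVector-injective along-v  along-u  ()
sideVector-injective along-v  diagonal ()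
sideVector-injective diagonal along-u  ()
sideVector-injective diagonal along-v  ()

segment-injectiveʳ : ∀ d p q → segment d p ≡ segment d q → p ≡ q
segment-injectiveʳ along-u  p q eq = cong proj₁ eq
segment-injectiveʳ along-v  p q eq = cong proj₁ eq
segment-injectiveʳ diagonal p q eq = ⊕-cancelʳ p q u (cong proj₁ eq)

-- The three types of edges have different direction vectors, so an edge determines its type, and
-- then its base point.
segment-injective : ∀ d d′ p q → segment d p ≡ segment d′ q → d ≡ d′ × p ≡ q
segment-injective d d′ p q eq
  with sideVector-injective d d′ (trans (sym (direction-segment d p))
         (trans (cong direction eq) (direction-segment d′ q)))
... | refl = refl , segment-injectiveʳ d p q eq

-- The common edge is written as a `segment` from both triangles. For equal orientations injectivity
-- makes the triangles equal, which adjacency excludes; for opposite ones it makes the base points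
-- differ by the offset of the common side.
adjacent⇒cross : ∀ s t → Adjacent s t → ∃ λ d → t ≡ cross d s
adjacent⇒cross (left , p) (left , q) (s≢t , e , e∈s , e∈t)
  with ∈-edges-left p e∈s | ∈-edges-left q e∈t
... | d , refl | d′ , eq =
  contradiction (cong (left ,_) (proj₂ (segment-injective d d′ p q eq))) s≢t
adjacent⇒cross (right , p) (right , q) (s≢t , e , e∈s , e∈t)
  with ∈-edges-right p e∈s | ∈-edges-right q e∈t
... | d , refl | d′ , eq with segment-injective d d′ (p ⊕ offset d) (q ⊕ offset d′) eq
...   | refl , eq′ = contradiction (cong (right ,_) (⊕-cancelʳ p q (offset d) eq′)) s≢t
adjacent⇒cross (left , p) (right , q) (s≢t , e , e∈s , e∈t)
  with ∈-edges-left p e∈s | ∈-edges-right q e∈t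
... | d , refl | d′ , eq with segment-injective d d′ p (q ⊕ offset d′) eq
...   | refl , refl = d , sym (cross-involutive d (right , q))
adjacent⇒cross (right , p) (left , q) (s≢t , e , e∈s , e∈t)
  with ∈-edges-right p e∈s | ∈-edges-left q e∈t
... | d , refl | d′ , eq with segment-injective d d′ (p ⊕ offset d) q eq
...   | refl , refl = d , refl

-- The sides prev and out meet in the lattice point around which the children of
-- the node are arranged: child x, turn (child x) and turn (turn (child x)).
record Node : Set where
  constructor node
  field
    cell          : Triangle
    prev next out : Side

open Node

-- The rotation is about the common endpoint of `prev` and `next`. The types of the six edges at a
-- lattice point repeat with period three, so the roles of the sides are permuted cyclically.
turn : Node → Node
turn (node t p n o) = node (cross n t) n o p

child : Node → Node
child (node t p n o) = node (cross o t) o n p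

fan : ℕ → Node → List Node
fan zero    y = []
fan (suc k) y = y ∷ fan k (turn y)

length-fan : ∀ k y → length (fan k y) ≡ k
length-fan zero    y = refl
length-fan (suc k) y = cong suc (length-fan k (turn y))

turn^ : ℕ → Node → Node
turn^ zero    y = y
turn^ (suc k) y = turn^ k (turn y)

-- This turns knowledge about the three labelled neighbours into knowledge about all neighbours.
Spans : Node → Set
Spans x = ∀ d → d ≡ prev x ⊎ d ≡ next x ⊎ d ≡ out x

-- When the sides are distinct, the triangles around the common endpoint of `next` and `out` of `x`
-- are, in order, `x`, `turn x`, the three candidates scanned from `turn x`, and `child x`.
cell-turn³-child-turn : ∀ x → cell (turn^ 3 (child (turn x))) ≡ cell (child x)
cell-turn³-child-turn (node t p n o) = cross-hexagon n p o t

-- The same lattice point, traversed in the other sense: `x`, `child x`, the three candidates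
-- scanned from `child x`, and `turn x`.
cell-turn³-child-child : ∀ x → cell (turn^ 3 (child (child x))) ≡ cell (turn x)
cell-turn³-child-child (node t p n o) = cross-hexagon o p n t

turn⁶ : ∀ x → turn^ 6 x ≡ x
turn⁶ (node t p n o) = cong (λ s → node s p n o)
  (trans (cong (cross p) (cross-hexagon n o p t)) (cross-involutive p t))

spans-turn : ∀ {x} → Spans x → Spans (turn x)
spans-turn s d with s d
... | inj₁ eq        = inj₂ (inj₂ eq)
... | inj₂ (inj₁ eq) = inj₁ eq
... | inj₂ (inj₂ eq) = inj₂ (inj₁ eq)

spans-child : ∀ {x} → Spans x → Spans (child x)
spans-child s d with s d
... | inj₁ eq        = inj₂ (inj₂ eq)
... | inj₂ (inj₁ eq) = inj₂ (inj₁ eq)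
... | inj₂ (inj₂ eq) = inj₁ eq

-- Exploring a polyiamond

Digits : ℕ → Set
Digits = Vec (Fin 4)

digitSum : ∀ {m} → Digits m → ℕ
digitSum []       = 0
digitSum (d ∷ ds) = toℕ d ℕ.+ digitSum ds

-- Replays an exploration from its digits alone, depth first: new nodes go on top of the stack. The
-- starting nodes are not listed, and digits left over when the stack is empty are ignored, so that
-- all codes can have the same length.
grow : ∀ {m} → List Node → Digits m → List Node
grow q       []       = []
grow []      (d ∷ ds) = []
grow (x ∷ q) (d ∷ ds) = fan (toℕ d) (child x) ++ grow (fan (toℕ d) (child x) ++ q) ds

module Explore (P : List Triangle) where

  -- `F` stands for the set of all triangles that are ever visited. It is available only when the
  -- exploration is complete, so the invariants are stated for an arbitrary `F` containing what is
  -- visited.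
  Known : (Triangle → Set) → Triangle → Set
  Known F t = t ∈ P → F t

  Closed : (Triangle → Set) → Node → Set
  Closed F x = Known F (cell (child x))

  -- turn^ 3 (child x) is the first triangle of the fan of x that gets no digit;
  -- around the lattice point it is two steps before x.
  record Framed (F : Triangle → Set) (x : Node) : Set where
    field
      cell-visited : F (cell x)
      prev-known   : Known F (cross (prev x) (cell x))
      next-known   : Known F (cell (turn x))
      fourth-known : Known F (cell (turn^ 3 (child x)))
      spans        : Spans x

  open Framed public

  -- Scan b y acc k: exactly the first k of the nodes y, turn y, … (at most b)
  -- are new cells of P.
  data Scan : ℕ → Node → List Triangle → ℕ → Set where
    budget  : ∀ {y acc} → Scan 0 y acc 0
    outside : ∀ {b y acc} → ¬ cell y ∈ P → Scan (suc b) y acc 0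
    old     : ∀ {b y acc} → cell y ∈ acc → Scan (suc b) y acc 0
    new     : ∀ {b y acc k} → cell y ∈ P → ¬ cell y ∈ acc →
              Scan b (turn y) (cell y ∷ acc) k → Scan (suc b) y acc (suc k)

  scan : ∀ b y acc → ∃ λ (d : Fin (suc b)) → Scan b y acc (toℕ d)
  scan zero    y acc = zero , budget
  scan (suc b) y acc with cell y ∈? P | cell y ∈? acc
  ... | no y∉P  | _         = zero , outside y∉P
  ... | yes _   | yes y∈acc = zero , old y∈acc
  ... | yes y∈P | no y∉acc  with scan b (turn y) (cell y ∷ acc)
  ...   | d , s = suc d , new y∈P y∉acc s

  gather : ℕ → Node → List Triangle → List Triangle
  gather zero    y acc = acc
  gather (suc k) y acc = gather k (turn y) (cell y ∷ acc)

  length-gather : ∀ k y acc → length (gather k y acc) ≡ k ℕ.+ length acc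
  length-gather zero    y acc = refl
  length-gather (suc k) y acc = trans (length-gather k (turn y) (cell y ∷ acc)) (ℕP.+-suc k (length acc))

  gather⊆ : ∀ {F : Triangle → Set} k y acc → (∀ {t} → t ∈ acc → F t) →
            All (F ∘ cell) (fan k y) → ∀ {t} → t ∈ gather k y acc → F t
  gather⊆ zero    y acc acc⊆F []         = acc⊆F
  gather⊆ {F} (suc k) y acc acc⊆F (Fy ∷ Fys) = gather⊆ k (turn y) (cell y ∷ acc) acc′⊆F Fys
    where
    acc′⊆F : ∀ {t} → t ∈ cell y ∷ acc → F t
    acc′⊆F (here refl) = Fy
    acc′⊆F (there t∈)  = acc⊆F t∈

  scan-sound : ∀ {b y acc k} → Scan b y acc k → All (λ x → cell x ∈ P) (fan k y)
  scan-sound budget         = []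
  scan-sound (outside _)    = []
  scan-sound (old _)        = []
  scan-sound (new y∈P _ s)  = y∈P ∷ scan-sound s

  scan-unique : ∀ {b y acc k} → Scan b y acc k → Unique acc → Unique (gather k y acc)
  scan-unique budget           distinct = distinct
  scan-unique (outside _)      distinct = distinct
  scan-unique (old _)          distinct = distinct
  scan-unique (new _ y∉acc s)  distinct = scan-unique s (AllP.¬Any⇒All¬ _ y∉acc ∷ distinct)

  module _ {F : Triangle → Set} where

    scan-first-known : ∀ {b y acc k} → Scan (suc b) y acc k → (∀ {t} → t ∈ acc → F t) →
      All (F ∘ cell) (fan k y) → Known F (cell y)
    scan-first-known (outside y∉P)  acc⊆F _        = λ y∈P → contradiction y∈P y∉P
    scan-first-known (old y∈acc)    acc⊆F _        = λ _ → acc⊆F y∈acc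
    scan-first-known (new _ _ _)    acc⊆F (Fy ∷ _) = λ _ → Fy

    -- With an exhausted budget, `turn^ b y` is `y` itself: the triangle that gets no digit is
    -- covered by the hypothesis on the end of the fan.
    scan-head-known : ∀ {b y acc k} → Scan b y acc k → (∀ {t} → t ∈ acc → F t) →
      All (F ∘ cell) (fan k y) → Known F (cell (turn^ b y)) → Known F (cell y)
    scan-head-known {zero}  s acc⊆F Fys end = end
    scan-head-known {suc b} s acc⊆F Fys end = scan-first-known s acc⊆F Fys

    -- The frame is passed along the fan: the triangle before `turn y` is `y`, and the fourth
    -- triangle of `turn y` is the outward neighbour of `y`, known because `y` is closed.
    scan-framed : ∀ {b y acc k} → Scan b y acc k → (∀ {t} → t ∈ acc → F t) →
      All (F ∘ cell) (fan k y) → All (Closed F) (fan k y) →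
      Known F (cross (prev y) (cell y)) → Known F (cell (turn^ 3 (child y))) →
      Known F (cell (turn^ b y)) → Spans y → All (Framed F) (fan k y)
    scan-framed budget      _ _ _ _ _ _ _ = []
    scan-framed (outside _) _ _ _ _ _ _ _ = []
    scan-framed (old _)     _ _ _ _ _ _ _ = []
    scan-framed {y = y} {acc} (new _ _ s) acc⊆F (Fy ∷ Fys) (closed ∷ closeds) before fourth end span =
      record
        { cell-visited = Fy
        ; prev-known   = before
        ; next-known   = scan-head-known s acc′⊆F Fys end
        ; fourth-known = fourth
        ; spans        = span
        } ∷
      scan-framed s acc′⊆F Fys closeds
        (subst (Known F) (sym (cross-involutive (next y) (cell y))) λ _ → Fy)
        (subst (Known F) (sym (cell-turn³-child-turn y)) closed)
        end (spans-turn {y} span)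
      where
      acc′⊆F : ∀ {t} → t ∈ cell y ∷ acc → F t
      acc′⊆F (here refl) = Fy
      acc′⊆F (there t∈)  = acc⊆F t∈

  -- `acc` holds the cells found so far, `q` the stack of unprocessed nodes. `closed` follows from
  -- the scans without any geometry; it is separate from `framed`, which needs the closedness of
  -- nodes that are processed later.
  record Exploration (m : ℕ) (acc : List Triangle) (q : List Node) : Set₁ where
    field
      digits  : Digits m
      bounded : digitSum digits ℕ.+ length acc ℕ.≤ length P
      sound   : All (λ x → cell x ∈ P) (grow q digits)
      closed  : ∀ {F : Triangle → Set} → (∀ {t} → t ∈ acc → F t) →
                All (F ∘ cell) (grow q digits) → All (Closed F) (q ++ grow q digits)
      framed  : ∀ {F : Triangle → Set} → (∀ {t} → t ∈ acc → F t) →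
                All (F ∘ cell) (grow q digits) → All (Framed F) q → All (Framed F) (grow q digits)

  open Exploration public

  digitSum-replicate : ∀ m → digitSum (Vec.replicate m zero) ≡ 0
  digitSum-replicate zero    = refl
  digitSum-replicate (suc m) = digitSum-replicate m

  -- Processing a node costs one digit, removes that node, and adds equally many nodes to the stack
  -- and cells to `acc`; so the fuel inequality persists. A node remaining without digits would make
  -- `acc` longer than `P`. The digit sum counts the new cells, which are distinct cells of `P`.
  explore : ∀ m acc q → Unique acc → acc ⊆ P →
            length q ℕ.+ length P ℕ.≤ m ℕ.+ length acc → Exploration m acc q
  explore zero acc (x ∷ q) distinct acc⊆P fuel = contradiction
    (ℕP.≤-trans (ℕP.m≤n+m (suc (length P)) (length q)) (subst (ℕ._≤ length acc) (sym (ℕP.+-suc (length q) (length P))) fuel))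
    (ℕP.<⇒≱ (ℕ.s≤s (unique⊆⇒length≤ distinct acc⊆P)))
  explore zero acc [] distinct acc⊆P fuel = record
    { digits  = []
    ; bounded = unique⊆⇒length≤ distinct acc⊆P
    ; sound   = []
    ; closed  = λ _ _ → []
    ; framed  = λ _ _ _ → []
    }
  explore (suc m) acc [] distinct acc⊆P fuel = record
    -- The exploration has ended early; zeros fill up the code without changing the digit sum.
    { digits  = Vec.replicate (suc m) zero
    ; bounded = subst (λ s → s ℕ.+ length acc ℕ.≤ length P) (sym (digitSum-replicate m))
                  (unique⊆⇒length≤ distinct acc⊆P)
    ; sound   = []
    ; closed  = λ _ _ → []
    ; framed  = λ _ _ _ → []
    }
  explore (suc m) acc (x ∷ q) distinct acc⊆P fuel with scan 3 (child x) acc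
  ... | d , s = record
    { digits  = d ∷ digits rest
    ; bounded = subst (ℕ._≤ length P) reorder (bounded rest)
    ; sound   = ++⁺ (scan-sound s) (sound rest)
    ; closed  = λ acc⊆F visited →
        let Fys  = ++⁻ˡ ys visited
            Fnew = ++⁻ʳ ys visited
            all  = closed rest (gather⊆ k (child x) acc acc⊆F Fys) Fnew
            allq = ++⁻ˡ (ys ++ q) all
        in scan-first-known s acc⊆F Fys ∷
             ++⁺ (++⁻ʳ ys allq) (++⁺ (++⁻ˡ ys allq) (++⁻ʳ (ys ++ q) all))
    ; framed  = λ {F} acc⊆F visited → λ where
        (fx ∷ fq) →
          let Fys  = ++⁻ˡ ys visited
              Fnew = ++⁻ʳ ys visited
              acc′⊆F = gather⊆ k (child x) acc acc⊆F Fys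
              all  = closed rest acc′⊆F Fnew
              -- The triangle before `child x` is `x`, its fourth triangle is `turn x`, and the fan
              -- of `x` ends at the fourth triangle of `x`; the frame of `x` covers all three.
              fys  = scan-framed s acc⊆F Fys (++⁻ˡ ys (++⁻ˡ (ys ++ q) all))
                       (subst (Known F) (sym (cross-involutive (out x) (cell x))) λ _ → cell-visited fx)
                       (subst (Known F) (sym (cell-turn³-child-child x)) (next-known fx))
                       (fourth-known fx) (spans-child {x} (spans fx))
          in ++⁺ fys (framed rest acc′⊆F Fnew (++⁺ fys fq))
    }
    where
    k = toℕ d
    ys = fan k (child x)
    acc′ = gather k (child x) acc
    fuel′ : length (ys ++ q) ℕ.+ length P ℕ.≤ m ℕ.+ length acc′
    fuel′ = begin
      length (ys ++ q) ℕ.+ length P          ≡⟨ cong (ℕ._+ length P) (length-++ ys) ⟩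
      length ys ℕ.+ length q ℕ.+ length P    ≡⟨ cong (λ j → j ℕ.+ length q ℕ.+ length P) (length-fan k (child x)) ⟩
      k ℕ.+ length q ℕ.+ length P            ≡⟨ ℕP.+-assoc k (length q) (length P) ⟩
      k ℕ.+ (length q ℕ.+ length P)          ≤⟨ ℕP.+-monoʳ-≤ k (ℕP.≤-pred fuel) ⟩
      k ℕ.+ (m ℕ.+ length acc)               ≡⟨ ℕSolver.solve 3 (λ a b c → a :+ (b :+ c) := b :+ (a :+ c)) refl k m (length acc) ⟩
      m ℕ.+ (k ℕ.+ length acc)               ≡⟨ cong (m ℕ.+_) (sym (length-gather k (child x) acc)) ⟩
      m ℕ.+ length acc′                      ∎
      where
      open ℕP.≤-Reasoning
      open ℕSolver using (_:+_; _:=_)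
    rest : Exploration m acc′ (ys ++ q)
    rest = explore m acc′ (ys ++ q) (scan-unique s distinct)
      (gather⊆ k (child x) acc acc⊆P (scan-sound s)) fuel′
    reorder : digitSum (digits rest) ℕ.+ length acc′ ≡ k ℕ.+ digitSum (digits rest) ℕ.+ length acc
    reorder = trans (cong (digitSum (digits rest) ℕ.+_) (length-gather k (child x) acc))
      (ℕSolver.solve 3 (λ a b c → b :+ (a :+ c) := a :+ b :+ c) refl k (digitSum (digits rest)) (length acc))
      where open ℕSolver using (_:+_; _:=_)

-- Marks and decoding

select : ∀ {A : Set} {m} → Digits m → List A → List A
select []           xs       = []
select (_ ∷ _)      []       = []
select (zero ∷ bs)  (x ∷ xs) = select bs xs
select (suc _ ∷ bs) (x ∷ xs) = x ∷ select bs xs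

module _ {A : Set} {Q : A → Set} (Q? : Decidable Q) where

  mark : (xs : List A) → Digits (length xs)
  mark []       = []
  mark (x ∷ xs) with Q? x
  ... | yes _ = suc zero ∷ mark xs
  ... | no  _ = zero ∷ mark xs

  digitSum-mark : ∀ xs → digitSum (mark xs) ℕ.≤ length xs
  digitSum-mark []       = ℕ.z≤n
  digitSum-mark (x ∷ xs) with Q? x
  ... | yes _ = ℕ.s≤s (digitSum-mark xs)
  ... | no  _ = ℕP.m≤n⇒m≤1+n (digitSum-mark xs)

  select-mark-sound : ∀ xs → All Q (select (mark xs) xs)
  select-mark-sound []       = []
  select-mark-sound (x ∷ xs) with Q? x
  ... | yes qx = qx ∷ select-mark-sound xs
  ... | no  _  = select-mark-sound xs

  select-mark-complete : ∀ {x} xs → x ∈ xs → Q x → x ∈ select (mark xs) xs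
  select-mark-complete (y ∷ xs) x∈ qx with Q? y | x∈
  ... | yes _  | here refl = here refl
  ... | yes _  | there x∈′ = there (select-mark-complete xs x∈′ qx)
  ... | no ¬qy | here refl = contradiction qx ¬qy
  ... | no _   | there x∈′ = select-mark-complete xs x∈′ qx

select-map : ∀ {A B : Set} (f : A → B) {m} (bs : Digits m) xs → select bs (map f xs) ≡ map f (select bs xs)
select-map f []           xs       = refl
select-map f (_ ∷ _)      []       = refl
select-map f (zero ∷ bs)  (x ∷ xs) = select-map f bs xs
select-map f (suc _ ∷ bs) (x ∷ xs) = cong (f x ∷_) (select-map f bs xs)

-- The exploration starts from all six triangles around a point, whether or not
-- they are cells; six further digits, 0 or 1, record which of them are.
origin : Vector → Node
origin p = node (left , p) along-u diagonal along-v

hexagon : Vector → List Node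
hexagon p = fan 6 (origin p)

-- Only the set of triangles matters: the exploration starts with an empty `acc`, so a cell of the
-- hexagon may be listed again later.
decode : ∀ {m} → Vector → Digits 6 → Digits m → List Triangle
decode p bs ds = map cell (select bs (hexagon p) ++ grow (hexagon p) ds)

move : Vector → Node → Node
move w (node t p n o) = node (translate w t) p n o

turn-move : ∀ w x → turn (move w x) ≡ move w (turn x)
turn-move w (node t p n o) = cong (λ s → node s n o p) (cross-translate w n t)

child-move : ∀ w x → child (move w x) ≡ move w (child x)
child-move w (node t p n o) = cong (λ s → node s o n p) (cross-translate w o t)

fan-move : ∀ w k x → fan k (move w x) ≡ map (move w) (fan k x)
fan-move w zero    x = refl
fan-move w (suc k) x =
  cong (move w x ∷_) (trans (cong (fan k) (turn-move w x)) (fan-move w k (turn x)))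

grow-move : ∀ w {m} q (ds : Digits m) → grow (map (move w) q) ds ≡ map (move w) (grow q ds)
grow-move w q       []       = refl
grow-move w []      (d ∷ ds) = refl
grow-move w (x ∷ q) (d ∷ ds) = begin
  fan k (child (move w x)) ++ grow (fan k (child (move w x)) ++ map (move w) q) ds
    ≡⟨ cong (λ ys → ys ++ grow (ys ++ map (move w) q) ds) fan-eq ⟩
  map (move w) ys ++ grow (map (move w) ys ++ map (move w) q) ds
    ≡⟨ cong (λ q′ → map (move w) ys ++ grow q′ ds) (sym (map-++ (move w) ys q)) ⟩
  map (move w) ys ++ grow (map (move w) (ys ++ q)) ds
    ≡⟨ cong (map (move w) ys ++_) (grow-move w (ys ++ q) ds) ⟩
  map (move w) ys ++ map (move w) (grow (ys ++ q) ds)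
    ≡⟨ sym (map-++ (move w) ys _) ⟩
  map (move w) (ys ++ grow (ys ++ q) ds) ∎
  where
  open ≡-Reasoning
  k = toℕ d
  ys = fan k (child x)
  fan-eq : fan k (child (move w x)) ≡ map (move w) ys
  fan-eq = trans (cong (fan k) (child-move w x)) (fan-move w k (child x))

-- All nodes arise from `origin p` by crossings, which commute with translations.
decode-translate : ∀ w p bs {m} (ds : Digits m) →
  map (translate w) (decode p bs ds) ≡ decode (p ⊕ w) bs ds
decode-translate w p bs ds = begin
  map (translate w) (map cell (select bs h ++ grow h ds))
    ≡⟨ trans (sym (map-∘ (select bs h ++ grow h ds))) (map-∘ (select bs h ++ grow h ds)) ⟩
  map cell (map (move w) (select bs h ++ grow h ds))
    ≡⟨ cong (map cell) (map-++ (move w) (select bs h) (grow h ds)) ⟩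
  map cell (map (move w) (select bs h) ++ map (move w) (grow h ds))
    ≡⟨ cong (map cell) (cong₂ _++_ (sym (select-map (move w) bs h)) (sym (grow-move w h ds))) ⟩
  map cell (select bs (map (move w) h) ++ grow (map (move w) h) ds)
    ≡⟨ cong (λ h′ → map cell (select bs h′ ++ grow h′ ds)) (sym (fan-move w 6 (origin p))) ⟩
  decode (p ⊕ w) bs ds ∎
  where
  open ≡-Reasoning
  h = hexagon p

anchor∈hexagon : ∀ o p → (o , p) ∈ map cell (hexagon p)
anchor∈hexagon left  p       = here refl
anchor∈hexagon right (a , b) =
  there (here (cong₂ (λ x y → right , x , y) (sym (ℤP.+-identityʳ a)) (sym (ℤP.+-identityʳ b))))

-- Every cell is reached

module _ (P : List Triangle) where

  open Explore P

  module _ {F : Triangle → Set} where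

    framed-turn : ∀ {x} → F (cell x) → F (cell (turn x)) → F (cell (turn (turn x))) →
                  Closed F x → Spans x → Framed F (turn x)
    framed-turn {x} before here′ after closed span = record
      { cell-visited = here′
      ; prev-known   = subst (Known F) (sym (cross-involutive (next x) (cell x))) λ _ → before
      ; next-known   = λ _ → after
      ; fourth-known = subst (Known F) (sym (cell-turn³-child-turn x)) closed
      ; spans        = spans-turn {x} span
      }

    -- Each triangle of the ring is the turn of its predecessor, so its two neighbours in the ring
    -- are visited and its fourth triangle is the outward neighbour of the predecessor.
    framed-ring : ∀ {x} → Spans x → All (F ∘ cell) (fan 6 x) → All (Closed F) (fan 6 x) →
                  All (Framed F) (fan 6 x)
    framed-ring {x} s (f₀ ∷ f₁ ∷ f₂ ∷ f₃ ∷ f₄ ∷ f₅ ∷ []) (c₀ ∷ c₁ ∷ c₂ ∷ c₃ ∷ c₄ ∷ c₅ ∷ []) =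
      -- The first node is reached as the turn of the last one.
      subst (Framed F) (turn⁶ x) (framed-turn f₅ f₆ f₇ c₅ (s′ 5)) ∷
      framed-turn f₀ f₁ f₂ c₀ (s′ 0) ∷
      framed-turn f₁ f₂ f₃ c₁ (s′ 1) ∷
      framed-turn f₂ f₃ f₄ c₂ (s′ 2) ∷
      framed-turn f₃ f₄ f₅ c₃ (s′ 3) ∷
      framed-turn f₄ f₅ f₆ c₄ (s′ 4) ∷ []
      where
      spans-turn^ : ∀ k y → Spans y → Spans (turn^ k y)
      spans-turn^ zero    y span = span
      spans-turn^ (suc k) y span = spans-turn^ k (turn y) (spans-turn {y} span)
      s′ : ∀ k → Spans (turn^ k x)
      s′ k = spans-turn^ k x s
      f₆ = subst (F ∘ cell) (sym (turn⁶ x)) f₀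
      f₇ = subst (F ∘ cell ∘ turn) (sym (turn⁶ x)) f₁

    framed⇒neighbours-known : ∀ {x} → Framed F x → Closed F x → ∀ d → Known F (cross d (cell x))
    framed⇒neighbours-known {x} f c d with spans f d
    ... | inj₁ refl        = prev-known f
    ... | inj₂ (inj₁ refl) = next-known f
    ... | inj₂ (inj₂ refl) = c

  module _ {m : ℕ} (q : List Node) (E : Exploration m [] q)
    (ring : ∀ {F} → All (F ∘ cell) q → All (Closed F) q → All (Framed F) q) where

    private
      V = q ++ grow q (digits E)

      -- The arbitrary `F` becomes the actual set of visited triangles, including the ring triangles
      -- outside `P`.
      Visited : Triangle → Set
      Visited t = t ∈ map cell V

      visited : All (Visited ∘ cell) V
      visited = All.tabulate (∈-map⁺ cell)

      allClosed : All (Closed Visited) V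
      allClosed = closed E (λ ()) (++⁻ʳ q visited)

      allFramed : All (Framed Visited) V
      allFramed = ++⁺ framed-q (framed E (λ ()) (++⁻ʳ q visited) framed-q)
        where
        framed-q : All (Framed Visited) q
        framed-q = ring (++⁻ˡ q visited) (++⁻ˡ q allClosed)

      step : ∀ {s t} → Visited s → t ∈ P → Adjacent s t → Visited t
      step {s} {t} vs t∈P adj with ∈-map⁻ cell vs | adjacent⇒cross s t adj
      ... | x , x∈ , refl | d , refl =
        framed⇒neighbours-known (All.lookup allFramed x∈) (All.lookup allClosed x∈) d t∈P

    reached : ∀ {s t} → Star (λ a b → a ∈ P × b ∈ P × Adjacent a b) s t → Visited s → Visited t
    reached stop                  vs = vs
    reached ((_ , b∈P , adj) ◅ r) vs = reached r (step vs b∈P adj)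

    -- Visited triangles pass visitedness on to all their neighbours in `P`, so connectedness
    -- spreads it from `s` to all of `P`. Visited triangles outside `P` occur only in `q`, and the
    -- marks remove them.
    marked-∼ : ∀ {s} → s ∈ P → Connected P → s ∈ map cell q →
      map cell (select (mark (λ x → cell x ∈? P) q) q ++ grow q (digits E)) ∼[ set ] P
    marked-∼ {s} s∈P conn s∈q = mk⇔ to from
      where
      Q? : Decidable (λ x → cell x ∈ P)
      Q? x = cell x ∈? P

      marked = select (mark Q? q) q

      start : Visited s
      start = subst (s ∈_) (sym (map-++ cell q (grow q (digits E)))) (∈-++⁺ˡ s∈q)

      to : ∀ {t} → t ∈ map cell (marked ++ grow q (digits E)) → t ∈ P
      to t∈ with ∈-map⁻ cell t∈
      ... | x , x∈ , refl = All.lookup (++⁺ (select-mark-sound Q? q) (sound E)) x∈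

      from : ∀ {t} → t ∈ P → t ∈ map cell (marked ++ grow q (digits E))
      from t∈P with ∈-map⁻ cell (reached (conn s∈P t∈P) start)
      ... | x , x∈ , refl with ∈-++⁻ q x∈
      ...   | inj₁ x∈q = ∈-map⁺ cell (∈-++⁺ˡ (select-mark-complete Q? q x∈q t∈P))
      ...   | inj₂ x∈g = ∈-map⁺ cell (∈-++⁺ʳ marked x∈g)

  explore-hexagon : ∀ p → Exploration (6 ℕ.+ length P) [] (hexagon p)
  explore-hexagon p = explore (6 ℕ.+ length P) [] (hexagon p) [] (λ ()) (ℕP.m≤m+n (6 ℕ.+ length P) 0)

-- Codes of polyiamonds

-- Six marks, then one digit for each processed node: the six of the ring and at most `n` new ones.
-- Marks share the alphabet `Fin 4` so that the whole code is weighed uniformly.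
Code : ℕ → Set
Code n = Digits (6 ℕ.+ (6 ℕ.+ n))

digitSum-++ : ∀ {k m} (bs : Digits k) (ds : Digits m) → digitSum (bs Vec.++ ds) ≡ digitSum bs ℕ.+ digitSum ds
digitSum-++ []       ds = refl
digitSum-++ (b ∷ bs) ds =
  trans (cong (toℕ b ℕ.+_) (digitSum-++ bs ds)) (sym (ℕP.+-assoc (toℕ b) (digitSum bs) (digitSum ds)))

record Encoding {n : ℕ} (P : Polyiamond n) : Set where
  field
    anchor  : Vector
    marks   : Digits 6
    growth  : Digits (6 ℕ.+ n)
    sum≤    : digitSum marks ℕ.+ digitSum growth ℕ.≤ 6 ℕ.+ n
    decodes : decode anchor marks growth ∼[ set ] cells P

open Encoding

spans-origin : ∀ p → Spans (origin p)
spans-origin p along-u  = inj₁ refl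
spans-origin p along-v  = inj₂ (inj₂ refl)
spans-origin p diagonal = inj₂ (inj₁ refl)

abstract
  encoding : ∀ {n} (P : Polyiamond n) → Encoding P
  encoding record { cells = [] ; nonempty = ne } = contradiction refl ne
  encoding P@record { cells = (o , p) ∷ ts ; size = refl } = record
    { anchor  = p
    ; marks   = mark (λ x → cell x ∈? cells P) (hexagon p)
    ; growth  = digits E
    ; sum≤    = ℕP.+-mono-≤ (digitSum-mark (λ x → cell x ∈? cells P) (hexagon p))
                  (ℕP.m+n≤o⇒m≤o (digitSum (digits E)) (bounded E))
    ; decodes = marked-∼ (cells P) (hexagon p) E (framed-ring (cells P) (spans-origin p))
                  (here refl) (connected P) (anchor∈hexagon o p)
    }
    where
    open Explore (cells P)
    E : Exploration (6 ℕ.+ length (cells P)) [] (hexagon p)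
    E = explore-hexagon (cells P) p

encode : ∀ {n} → Polyiamond n → Code n
encode P = marks (encoding P) Vec.++ growth (encoding P)

digitSum-encode : ∀ {n} (P : Polyiamond n) → digitSum (encode P) ℕ.≤ 6 ℕ.+ n
digitSum-encode {n} P = subst (ℕ._≤ 6 ℕ.+ n)
  (sym (digitSum-++ (marks (encoding P)) (growth (encoding P)))) (sum≤ (encoding P))

⊕-⊖ : ∀ p q → p ⊕ (q ⊖ p) ≡ q
⊕-⊖ p q = cong₂ _,_ (lemma (proj₁ p) (proj₁ q)) (lemma (proj₂ p) (proj₂ q))
  where
  lemma : ∀ a b → a ℤ.+ (b ℤ.- a) ≡ b
  lemma = solve-∀

-- The code may depend on how the cells are listed; what counts is that equal codes decode to sets
-- differing by the translation between the anchors.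
encode-injective : ∀ {n} (P Q : Polyiamond n) → encode P ≡ encode Q → Q IsTranslateOf P
encode-injective P Q eq = w ,
  SetEq.trans (BagAndSet.map-cong (λ _ → refl) (SetEq.sym (decodes p)))
    (SetEq.trans (SetEq.reflexive same) (decodes q))
  where
  module SetEq = Setoid (BagAndSet.[ SymmetricKind.equivalence ]-Equality Triangle)
  p = encoding P
  q = encoding Q
  w = anchor q ⊖ anchor p
  same : map (translate w) (decode (anchor p) (marks p) (growth p)) ≡ decode (anchor q) (marks q) (growth q)
  same with ++-injective (marks p) (marks q) eq
  ... | bs≡ , ds≡ = trans (decode-translate w (anchor p) (marks p) (growth p))
    (trans (cong (λ r → decode r (marks p) (growth p)) (⊕-⊖ (anchor p) (anchor q)))
      (cong₂ (decode (anchor q)) bs≡ ds≡))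

-- Inequalities between rational numbers

+-nonNeg : ∀ {p q} → 0ℚ ℚ.≤ p → 0ℚ ℚ.≤ q → 0ℚ ℚ.≤ p ℚ.+ q
+-nonNeg = ℚP.+-mono-≤

*-nonNeg : ∀ {p q} → 0ℚ ℚ.≤ p → 0ℚ ℚ.≤ q → 0ℚ ℚ.≤ p ℚ.* q
*-nonNeg {p} {q} 0≤p 0≤q = ℚP.nonNegative⁻¹ (p ℚ.* q)
  {{ℚP.nonNeg*nonNeg⇒nonNeg p {{ℚ.nonNegative 0≤p}} q {{ℚ.nonNegative 0≤q}}}}

*-pos : ∀ {p q} → 0ℚ ℚ.< p → 0ℚ ℚ.< q → 0ℚ ℚ.< p ℚ.* q
*-pos {p} {q} 0<p 0<q = ℚP.positive⁻¹ (p ℚ.* q)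
  {{ℚP.pos*pos⇒pos p {{ℚ.positive 0<p}} q {{ℚ.positive 0<q}}}}

*-monoˡ-≤ : ∀ r {p q} → 0ℚ ℚ.≤ r → p ℚ.≤ q → r ℚ.* p ℚ.≤ r ℚ.* q
*-monoˡ-≤ r 0≤r = ℚP.*-monoˡ-≤-nonNeg r {{ℚ.nonNegative 0≤r}}

*-monoʳ-≤ : ∀ r {p q} → 0ℚ ℚ.≤ r → p ℚ.≤ q → p ℚ.* r ℚ.≤ q ℚ.* r
*-monoʳ-≤ r 0≤r = ℚP.*-monoʳ-≤-nonNeg r {{ℚ.nonNegative 0≤r}}

≤-excess : ∀ {p q r} → 0ℚ ℚ.≤ r → p ℚ.+ r ≡ q → p ℚ.≤ q
≤-excess {p} {r = r} 0≤r refl = subst (ℚ._≤ p ℚ.+ r) (ℚP.+-identityʳ p) (ℚP.+-monoʳ-≤ p 0≤r)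

p≤q⇒0≤q-p : ∀ {p q} → p ℚ.≤ q → 0ℚ ℚ.≤ q ℚ.- p
p≤q⇒0≤q-p {p} {q} p≤q = subst (ℚ._≤ q ℚ.- p) (ℚP.+-inverseʳ p) (ℚP.+-monoˡ-≤ (ℚ.- p) p≤q)

square-nonNeg : ∀ p → 0ℚ ℚ.≤ p ℚ.* p
square-nonNeg p = subst (0ℚ ℚ.≤_) (trans (sym (ℚP.∣p*q∣≡∣p∣*∣q∣ p p)) abs-square)
  (*-nonNeg (ℚP.0≤∣p∣ p) (ℚP.0≤∣p∣ p))
  where
  abs-square : ℚ.∣ p ℚ.* p ∣ ≡ p ℚ.* p
  abs-square with ℚP.∣p∣≡p∨∣p∣≡-p p
  ... | inj₁ eq = trans (ℚP.∣p*q∣≡∣p∣*∣q∣ p p) (cong₂ ℚ._*_ eq eq)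
  ... | inj₂ eq = trans (ℚP.∣p*q∣≡∣p∣*∣q∣ p p) (trans (cong₂ ℚ._*_ eq eq)
    (ℚSolver.solve 1 (λ a → (:- a) :* (:- a) := a :* a) refl p))
    where open ℚSolver using (:-_; _:*_; _:=_)

p≤∣p∣ : ∀ p → p ℚ.≤ ℚ.∣ p ∣
p≤∣p∣ p with ℚP.≤-total 0ℚ p
... | inj₁ 0≤p = ℚP.≤-reflexive (sym (ℚP.0≤p⇒∣p∣≡p 0≤p))
... | inj₂ p≤0 = ℚP.≤-trans p≤0 (ℚP.0≤∣p∣ p)

-p≤∣p∣ : ∀ p → ℚ.- p ℚ.≤ ℚ.∣ p ∣
-p≤∣p∣ p = subst (ℚ.- p ℚ.≤_) (ℚP.∣-p∣≡∣p∣ p) (p≤∣p∣ (ℚ.- p))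

^-nonNeg : ∀ {q} → 0ℚ ℚ.≤ q → ∀ n → 0ℚ ℚ.≤ q ^ᵠ n
^-nonNeg 0≤q zero    = ℚP.nonNegative⁻¹ 1ℚ
^-nonNeg 0≤q (suc n) = *-nonNeg 0≤q (^-nonNeg 0≤q n)

^-pos : ∀ {q} → 0ℚ ℚ.< q → ∀ n → 0ℚ ℚ.< q ^ᵠ n
^-pos 0<q zero    = ℚP.positive⁻¹ 1ℚ
^-pos 0<q (suc n) = *-pos 0<q (^-pos 0<q n)

^-antimono : ∀ {q m n} → 0ℚ ℚ.≤ q → q ℚ.≤ 1ℚ → m ℕ.≤ n → q ^ᵠ n ℚ.≤ q ^ᵠ m
^-antimono {n = zero}  0≤q q≤1 ℕ.z≤n = ℚP.≤-refl
^-antimono {q} {n = suc n} 0≤q q≤1 ℕ.z≤n = begin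
  q ℚ.* q ^ᵠ n   ≤⟨ *-monoʳ-≤ (q ^ᵠ n) (^-nonNeg 0≤q n) q≤1 ⟩
  1ℚ ℚ.* q ^ᵠ n  ≡⟨ ℚP.*-identityˡ (q ^ᵠ n) ⟩
  q ^ᵠ n         ≤⟨ ^-antimono {n = n} 0≤q q≤1 ℕ.z≤n ⟩
  1ℚ             ∎
  where open ℚP.≤-Reasoning
^-antimono {q} 0≤q q≤1 (ℕ.s≤s m≤n) = *-monoˡ-≤ q 0≤q (^-antimono 0≤q q≤1 m≤n)

ι : ℕ → ℚ
ι n = + n ℚ./ 1

toℚᵘ-/ : ∀ a b → toℚᵘ (+ a ℚ./ suc b) ℚᵘ.≃ mkℚᵘ (+ a) b
toℚᵘ-/ a b = ℚP.toℚᵘ-fromℚᵘ (mkℚᵘ (+ a) b)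

ι-suc : ∀ n → ι (suc n) ≡ 1ℚ ℚ.+ ι n
ι-suc n = ℚP.toℚᵘ-injective (begin
  toℚᵘ (ι (suc n))                  ≈⟨ toℚᵘ-/ (suc n) 0 ⟩
  mkℚᵘ (+ suc n) 0                  ≈⟨ *≡* (lemma (+ n)) ⟩
  mkℚᵘ (+ 1) 0 ℚᵘ.+ mkℚᵘ (+ n) 0    ≈⟨ ℚᵘP.+-cong (toℚᵘ-/ 1 0) (toℚᵘ-/ n 0) ⟨
  toℚᵘ 1ℚ ℚᵘ.+ toℚᵘ (ι n)           ≈⟨ ℚP.toℚᵘ-homo-+ 1ℚ (ι n) ⟨
  toℚᵘ (1ℚ ℚ.+ ι n)                 ∎)
  where
  open import Relation.Binary.Reasoning.Setoid ℚᵘP.≃-setoid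
  lemma : ∀ k → (1ℤ ℤ.+ k) ℤ.* 1ℤ ≡ (1ℤ ℤ.* 1ℤ ℤ.+ k ℤ.* 1ℤ) ℤ.* 1ℤ
  lemma = solve-∀

/-*-ι : ∀ a b → (+ a ℚ./ suc b) ℚ.* ι (suc b) ≡ ι a
/-*-ι a b = ℚP.toℚᵘ-injective (begin
  toℚᵘ ((+ a ℚ./ suc b) ℚ.* ι (suc b))        ≈⟨ ℚP.toℚᵘ-homo-* (+ a ℚ./ suc b) (ι (suc b)) ⟩
  toℚᵘ (+ a ℚ./ suc b) ℚᵘ.* toℚᵘ (ι (suc b))  ≈⟨ ℚᵘP.*-cong (toℚᵘ-/ a b) (toℚᵘ-/ (suc b) 0) ⟩
  mkℚᵘ (+ a) b ℚᵘ.* mkℚᵘ (+ suc b) 0          ≈⟨ *≡* (trans (lemma (+ a) (+ suc b)) (cong (λ k → + a ℤ.* + k) (sym (ℕP.*-identityʳ (suc b))))) ⟩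
  mkℚᵘ (+ a) 0                                ≈⟨ toℚᵘ-/ a 0 ⟨
  toℚᵘ (ι a)                                  ∎)
  where
  open import Relation.Binary.Reasoning.Setoid ℚᵘP.≃-setoid
  lemma : ∀ x y → x ℤ.* y ℤ.* 1ℤ ≡ x ℤ.* y
  lemma = solve-∀

ι-nonNeg : ∀ n → 0ℚ ℚ.≤ ι n
ι-nonNeg zero    = ℚP.≤-refl
ι-nonNeg (suc n) = subst (0ℚ ℚ.≤_) (sym (ι-suc n)) (+-nonNeg (ℚP.nonNegative⁻¹ 1ℚ) (ι-nonNeg n))

ι-suc-pos : ∀ n → 0ℚ ℚ.< ι (suc n)
ι-suc-pos n = subst (0ℚ ℚ.<_) (sym (ι-suc n)) (ℚP.+-mono-<-≤ (ℚP.positive⁻¹ 1ℚ) (ι-nonNeg n))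

below-ℕ : ∀ p → ∃ λ k → p ℚ.< ι k
below-ℕ p@(mkℚ (+ a) d _) = suc a , ℚP.toℚᵘ-cancel-< (ℚᵘP.<-respʳ-≃ (ℚᵘP.≃-sym (toℚᵘ-/ (suc a) 0)) (*<* (subst₂ ℤ._<_ (ℤP.pos-* a 1) (ℤP.pos-* (suc a) (suc d)) (ℤ.+<+ a<))))
  where
  a< : a ℕ.* 1 ℕ.< suc a ℕ.* suc d
  a< = subst (ℕ._< suc a ℕ.* suc d) (sym (ℕP.*-identityʳ a)) (ℕP.m≤m*n (suc a) (suc d))
below-ℕ p@(mkℚ -[1+ a ] d _) = 0 , ℚP.negative⁻¹ p

archimedean : ∀ {c} D → 0ℚ ℚ.< c → ∃ λ k → D ℚ.< ι k ℚ.* c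
archimedean {c} D 0<c = k , subst (ℚ._< ι k ℚ.* c) cancel (ℚP.*-monoˡ-<-pos c (proj₂ (below-ℕ (D ℚ.* c⁻¹))))
  where
  instance
    c-pos : ℚ.Positive c
    c-pos = ℚ.positive 0<c
    c-nonZero : ℚ.NonZero c
    c-nonZero = ℚP.pos⇒nonZero c
  c⁻¹ = ℚ.1/ c
  k = proj₁ (below-ℕ (D ℚ.* c⁻¹))
  cancel : D ℚ.* c⁻¹ ℚ.* c ≡ D
  cancel = trans (ℚP.*-assoc D c⁻¹ c) (trans (cong (D ℚ.*_) (ℚP.*-inverseˡ c)) (ℚP.*-identityʳ D))

-- Bernoulli's inequality for ((H + η) / H) ^ k, multiplied by H ^ (k + 1) to avoid division.
bernoulli : ∀ {H η} (s : ℕ → ℚ) → 0ℚ ℚ.≤ H → 0ℚ ℚ.≤ η → 0ℚ ℚ.≤ s 0 →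
  (∀ k → (H ℚ.+ η) ℚ.* s k ℚ.≤ s (suc k)) →
  ∀ k → H ^ᵠ k ℚ.* ((H ℚ.+ ι k ℚ.* η) ℚ.* s 0) ℚ.≤ H ℚ.* s k
bernoulli {H} {η} s 0≤H 0≤η 0≤s₀ grows zero = ℚP.≤-reflexive (start H η (s 0))
  where
  open ℚSolver
  start : ∀ h e x → 1ℚ ℚ.* ((h ℚ.+ 0ℚ ℚ.* e) ℚ.* x) ≡ h ℚ.* x
  start = solve 3 (λ h e x → con 1ℚ :* ((h :+ con 0ℚ :* e) :* x) := h :* x) refl
bernoulli {H} {η} s 0≤H 0≤η 0≤s₀ grows (suc k) = begin
  H ℚ.* Hᵏ ℚ.* ((H ℚ.+ ι (suc k) ℚ.* η) ℚ.* s 0)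
    ≡⟨ cong (λ j → H ℚ.* Hᵏ ℚ.* ((H ℚ.+ j ℚ.* η) ℚ.* s 0)) (ι-suc k) ⟩
  H ℚ.* Hᵏ ℚ.* ((H ℚ.+ (1ℚ ℚ.+ ι k) ℚ.* η) ℚ.* s 0)
    ≤⟨ ≤-excess (*-nonNeg (*-nonNeg (^-nonNeg 0≤H k) (*-nonNeg (ι-nonNeg k) (*-nonNeg 0≤η 0≤η))) 0≤s₀)
         (expand H Hᵏ (ι k) η (s 0)) ⟩
  (H ℚ.+ η) ℚ.* (Hᵏ ℚ.* ((H ℚ.+ ι k ℚ.* η) ℚ.* s 0))
    ≤⟨ *-monoˡ-≤ (H ℚ.+ η) (+-nonNeg 0≤H 0≤η) (bernoulli s 0≤H 0≤η 0≤s₀ grows k) ⟩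
  (H ℚ.+ η) ℚ.* (H ℚ.* s k)
    ≡⟨ swap (H ℚ.+ η) H (s k) ⟩
  H ℚ.* ((H ℚ.+ η) ℚ.* s k)
    ≤⟨ *-monoˡ-≤ H 0≤H (grows k) ⟩
  H ℚ.* s (suc k) ∎
  where
  open ℚP.≤-Reasoning
  open ℚSolver
  Hᵏ = H ^ᵠ k
  expand : ∀ h hk j e x →
    h ℚ.* hk ℚ.* ((h ℚ.+ (1ℚ ℚ.+ j) ℚ.* e) ℚ.* x) ℚ.+ hk ℚ.* (j ℚ.* (e ℚ.* e)) ℚ.* x
      ≡ (h ℚ.+ e) ℚ.* (hk ℚ.* ((h ℚ.+ j ℚ.* e) ℚ.* x))
  expand = solve 5 (λ h hk j e x →
    h :* hk :* ((h :+ (con 1ℚ :+ j) :* e) :* x) :+ hk :* (j :* (e :* e)) :* x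
      := (h :+ e) :* (hk :* ((h :+ j :* e) :* x))) refl
  swap : ∀ a h x → a ℚ.* (h ℚ.* x) ≡ h ℚ.* (a ℚ.* x)
  swap = solve 3 (λ a h x → a :* (h :* x) := h :* (a :* x)) refl

-- Bernoulli's inequality would bound `(H + kη) · s 0` by `H · C` for every `k`, against the
-- Archimedean property.
faster-growth-unbounded : ∀ {H η C} (s : ℕ → ℚ) → 0ℚ ℚ.< H → 0ℚ ℚ.< η → 0ℚ ℚ.< s 0 →
  (∀ k → (H ℚ.+ η) ℚ.* s k ℚ.≤ s (suc k)) → ¬ (∀ k → s k ℚ.≤ C ℚ.* H ^ᵠ k)
faster-growth-unbounded {H} {η} {C} s 0<H 0<η 0<s₀ grows bound = ℚP.<-irrefl refl (begin-strict
  H ℚ.* C                           <⟨ proj₂ multiple ⟩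
  ι k ℚ.* (η ℚ.* s 0)               ≤⟨ ≤-excess (*-nonNeg (ℚP.<⇒≤ 0<H) (ℚP.<⇒≤ 0<s₀)) (factor (ι k) η (s 0) H) ⟩
  (H ℚ.+ ι k ℚ.* η) ℚ.* s 0         ≤⟨ ℚP.*-cancelˡ-≤-pos Hᵏ {{ℚ.positive (^-pos 0<H k)}} scaled ⟩
  H ℚ.* C                           ∎)
  where
  open ℚP.≤-Reasoning
  open ℚSolver using (solve; _:=_; _:*_; _:+_)
  multiple : ∃ λ k → H ℚ.* C ℚ.< ι k ℚ.* (η ℚ.* s 0)
  multiple = archimedean (H ℚ.* C) (*-pos 0<η 0<s₀)
  k = proj₁ multiple
  Hᵏ = H ^ᵠ k
  factor : ∀ j e x h → j ℚ.* (e ℚ.* x) ℚ.+ h ℚ.* x ≡ (h ℚ.+ j ℚ.* e) ℚ.* x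
  factor = solve 4 (λ j e x h → j :* (e :* x) :+ h :* x := (h :+ j :* e) :* x) refl
  rotate : ∀ h c x → h ℚ.* (c ℚ.* x) ≡ x ℚ.* (h ℚ.* c)
  rotate = solve 3 (λ h c x → h :* (c :* x) := x :* (h :* c)) refl
  scaled : Hᵏ ℚ.* ((H ℚ.+ ι k ℚ.* η) ℚ.* s 0) ℚ.≤ Hᵏ ℚ.* (H ℚ.* C)
  scaled = begin
    Hᵏ ℚ.* ((H ℚ.+ ι k ℚ.* η) ℚ.* s 0)  ≤⟨ bernoulli s (ℚP.<⇒≤ 0<H) (ℚP.<⇒≤ 0<η) (ℚP.<⇒≤ 0<s₀) grows k ⟩
    H ℚ.* s k                           ≤⟨ *-monoˡ-≤ H (ℚP.<⇒≤ 0<H) (bound k) ⟩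
    H ℚ.* (C ℚ.* Hᵏ)                    ≡⟨ rotate H C Hᵏ ⟩
    Hᵏ ℚ.* (H ℚ.* C)                    ∎

-- Counting digit sequences

-- The generating polynomial of the digit sum, evaluated at `q`.
weight : ∀ {m} → ℚ → List (Digits m) → ℚ
weight q []         = 0ℚ
weight q (ds ∷ dss) = q ^ᵠ digitSum ds ℚ.+ weight q dss

weight-++ : ∀ {m} q (xs ys : List (Digits m)) → weight q (xs ++ ys) ≡ weight q xs ℚ.+ weight q ys
weight-++ q []       ys = sym (ℚP.+-identityˡ (weight q ys))
weight-++ q (x ∷ xs) ys = trans (cong (q ^ᵠ digitSum x ℚ.+_) (weight-++ q xs ys))
  (sym (ℚP.+-assoc (q ^ᵠ digitSum x) (weight q xs) (weight q ys)))

weight-↭ : ∀ {m} q {xs ys : List (Digits m)} → xs ↭ ys → weight q xs ≡ weight q ys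
weight-↭ q Perm.refl          = refl
weight-↭ q (Perm.prep x p)    = cong (q ^ᵠ digitSum x ℚ.+_) (weight-↭ q p)
weight-↭ q (Perm.swap {xs} {ys} x y p) = trans
  (cong (λ w → q ^ᵠ digitSum x ℚ.+ (q ^ᵠ digitSum y ℚ.+ w)) (weight-↭ q p))
  (exchange (q ^ᵠ digitSum x) (q ^ᵠ digitSum y) (weight q ys))
  where
  open ℚSolver
  exchange : ∀ a b c → a ℚ.+ (b ℚ.+ c) ≡ b ℚ.+ (a ℚ.+ c)
  exchange = solve 3 (λ a b c → a :+ (b :+ c) := b :+ (a :+ c)) refl
weight-↭ q (Perm.trans p p′)  = trans (weight-↭ q p) (weight-↭ q p′)

weight-nonNeg : ∀ {m q} → 0ℚ ℚ.≤ q → (xs : List (Digits m)) → 0ℚ ℚ.≤ weight q xs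
weight-nonNeg 0≤q []       = ℚP.≤-refl
weight-nonNeg 0≤q (x ∷ xs) = +-nonNeg (^-nonNeg 0≤q (digitSum x)) (weight-nonNeg 0≤q xs)

weight-mono : ∀ {m q} → 0ℚ ℚ.≤ q → {xs ys : List (Digits m)} → Unique xs → xs ⊆ ys →
  weight q xs ℚ.≤ weight q ys
weight-mono {q = q} 0≤q {xs} {ys} distinct xs⊆ys =
  ≤-excess (weight-nonNeg 0≤q zs) (sym (trans (weight-↭ q ys↭) (weight-++ q xs zs)))
  where
  zs = proj₁ (unique⊆⇒↭ distinct xs⊆ys)
  ys↭ : ys ↭ xs ++ zs
  ys↭ = proj₂ (unique⊆⇒↭ distinct xs⊆ys)

weight-≥ : ∀ {m q s} → 0ℚ ℚ.≤ q → q ℚ.≤ 1ℚ → (xs : List (Digits m)) →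
  All (λ ds → digitSum ds ℕ.≤ s) xs → ι (length xs) ℚ.* q ^ᵠ s ℚ.≤ weight q xs
weight-≥ {q = q} {s} 0≤q q≤1 []       []       = ℚP.≤-reflexive (ℚP.*-zeroˡ (q ^ᵠ s))
weight-≥ {q = q} {s} 0≤q q≤1 (x ∷ xs) (p ∷ ps) = begin
  ι (suc (length xs)) ℚ.* q ^ᵠ s             ≡⟨ cong (ℚ._* q ^ᵠ s) (ι-suc (length xs)) ⟩
  (1ℚ ℚ.+ ι (length xs)) ℚ.* q ^ᵠ s          ≡⟨ ℚP.*-distribʳ-+ (q ^ᵠ s) 1ℚ (ι (length xs)) ⟩
  1ℚ ℚ.* q ^ᵠ s ℚ.+ ι (length xs) ℚ.* q ^ᵠ s ≡⟨ cong (ℚ._+ ι (length xs) ℚ.* q ^ᵠ s) (ℚP.*-identityˡ (q ^ᵠ s)) ⟩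
  q ^ᵠ s ℚ.+ ι (length xs) ℚ.* q ^ᵠ s        ≤⟨ ℚP.+-mono-≤ (^-antimono 0≤q q≤1 p) (weight-≥ 0≤q q≤1 xs ps) ⟩
  q ^ᵠ digitSum x ℚ.+ weight q xs            ∎
  where open ℚP.≤-Reasoning

allDigits : ∀ m → List (Digits m)
allDigits zero    = [] ∷ []
allDigits (suc m) = cartesianProductWith _∷_ (allFin 4) (allDigits m)

∈-allDigits : ∀ {m} (ds : Digits m) → ds ∈ allDigits m
∈-allDigits []       = here refl
∈-allDigits (d ∷ ds) = ∈-cartesianProductWith⁺ _∷_ (∈-allFin d) (∈-allDigits ds)

weight-∷ : ∀ {m} q d (xs : List (Digits m)) → weight q (map (d ∷_) xs) ≡ q ^ᵠ toℕ d ℚ.* weight q xs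
weight-∷ q d []       = sym (ℚP.*-zeroʳ (q ^ᵠ toℕ d))
weight-∷ q d (x ∷ xs) = trans
  (cong₂ ℚ._+_ (^-homo-* q (toℕ d) (digitSum x)) (weight-∷ q d xs))
  (sym (ℚP.*-distribˡ-+ (q ^ᵠ toℕ d) (q ^ᵠ digitSum x) (weight q xs)))

digitWeight : ℚ → ℚ
digitWeight q = 1ℚ ℚ.+ q ℚ.+ q ℚ.* q ℚ.+ q ℚ.* q ℚ.* q

weight-product : ∀ {m} q ds (xs : List (Digits m)) →
  weight q (cartesianProductWith _∷_ ds xs) ≡ weight q (map (_∷ []) ds) ℚ.* weight q xs
weight-product q []       xs = sym (ℚP.*-zeroˡ (weight q xs))
weight-product q (d ∷ ds) xs = begin
  weight q (map (d ∷_) xs ++ cartesianProductWith _∷_ ds xs)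
    ≡⟨ weight-++ q (map (d ∷_) xs) (cartesianProductWith _∷_ ds xs) ⟩
  weight q (map (d ∷_) xs) ℚ.+ weight q (cartesianProductWith _∷_ ds xs)
    ≡⟨ cong₂ ℚ._+_ (weight-∷ q d xs) (weight-product q ds xs) ⟩
  q ^ᵠ toℕ d ℚ.* weight q xs ℚ.+ weight q (map (_∷ []) ds) ℚ.* weight q xs
    ≡⟨ sym (ℚP.*-distribʳ-+ (weight q xs) (q ^ᵠ toℕ d) (weight q (map (_∷ []) ds))) ⟩
  (q ^ᵠ toℕ d ℚ.+ weight q (map (_∷ []) ds)) ℚ.* weight q xs
    ≡⟨ cong (λ k → (q ^ᵠ k ℚ.+ weight q (map (_∷ []) ds)) ℚ.* weight q xs) (sym (ℕP.+-identityʳ (toℕ d))) ⟩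
  (q ^ᵠ (toℕ d ℕ.+ 0) ℚ.+ weight q (map (_∷ []) ds)) ℚ.* weight q xs ∎
  where open ≡-Reasoning

weight-digit : ∀ q → weight q (map (_∷ []) (allFin 4)) ≡ digitWeight q
weight-digit = solve 1 (λ q →
  con 1ℚ :+ (q :* con 1ℚ :+ (q :* (q :* con 1ℚ) :+ (q :* (q :* (q :* con 1ℚ)) :+ con 0ℚ)))
    := con 1ℚ :+ q :+ q :* q :+ q :* q :* q) refl
  where open ℚSolver

weight-allDigits : ∀ q m → weight q (allDigits m) ≡ digitWeight q ^ᵠ m
weight-allDigits q zero    = refl
weight-allDigits q (suc m) = trans (weight-product q (allFin 4) (allDigits m))
  (cong₂ ℚ._*_ (weight-digit q) (weight-allDigits q m))

-- The codes are distinct and, as `q ≤ 1`, each weighs at least `q ^ᵠ (6 + n)`, while the weight of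
-- all digit sequences is a power of the weight of one digit.
polyiamonds-bound : ∀ {n t} → HasCardinality (Polyiamonds n) t →
  ∀ {q} → 0ℚ ℚ.≤ q → q ℚ.≤ 1ℚ → ι t ℚ.* q ^ᵠ (6 ℕ.+ n) ℚ.≤ digitWeight q ^ᵠ (12 ℕ.+ n)
polyiamonds-bound {n} {t} card {q} 0≤q q≤1 = begin
  ι t ℚ.* q ^ᵠ (6 ℕ.+ n)                ≡⟨ cong (λ k → ι k ℚ.* q ^ᵠ (6 ℕ.+ n)) (sym (length-tabulate code)) ⟩
  ι (length codes) ℚ.* q ^ᵠ (6 ℕ.+ n)   ≤⟨ weight-≥ {s = 6 ℕ.+ n} 0≤q q≤1 codes (AllP.tabulate⁺ λ i → digitSum-encode (Bijection.to card i)) ⟩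
  weight q codes                        ≤⟨ weight-mono 0≤q (UniqueP.tabulate⁺ code-injective) (λ {ds} _ → ∈-allDigits ds) ⟩
  weight q (allDigits (12 ℕ.+ n))       ≡⟨ weight-allDigits q (12 ℕ.+ n) ⟩
  digitWeight q ^ᵠ (12 ℕ.+ n)           ∎
  where
  open ℚP.≤-Reasoning
  code : Fin t → Code n
  code i = encode (Bijection.to card i)
  codes : List (Code n)
  codes = tabulate code
  code-injective : ∀ {i j} → code i ≡ code j → i ≡ j
  code-injective {i} {j} eq = Bijection.injective card
    (encode-injective (Bijection.to card i) (Bijection.to card j) eq)

-- The bound on the growth constant

-- Bracketed, and with the trailing factors `ι 1`, so that the terms of the real expression in the
-- equation for `z` are `cubic (seq z n)` by definition; likewise for `bound`.
cubic : ℚ → ℚ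
cubic q = ι 2 ℚ.* (q ℚ.* (q ℚ.* (q ℚ.* ι 1))) ℚ.+ q ℚ.* (q ℚ.* ι 1) ℚ.+ (ℚ.- ι 1)

bound : ℚ → ℚ
bound q = ι 1 ℚ.+ ι 2 ℚ.* q ℚ.+ ι 3 ℚ.* (q ℚ.* (q ℚ.* ι 1))

-- The value of `cubic` at ½ is -½, and the cofactor 2q² + 2q + 1 is a sum of two squares. With the
-- next lemma this puts rational approximations of `z` into [½, 1].
-cubic<½⇒½≤ : ∀ q → ℚ.- cubic q ℚ.< ½ → ½ ℚ.≤ q
-cubic<½⇒½≤ q -f<½ = ℚP.≮⇒≥ λ q<½ → ℚP.<-irrefl refl (ℚP.<-≤-trans -f<½
  (≤-excess (*-nonNeg (p≤q⇒0≤q-p (ℚP.<⇒≤ q<½)) (+-nonNeg (square-nonNeg q) (square-nonNeg (q ℚ.+ 1ℚ)))) (factor q)))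
  where
  open ℚSolver
  factor : ∀ q → ½ ℚ.+ (½ ℚ.- q) ℚ.* (q ℚ.* q ℚ.+ (q ℚ.+ 1ℚ) ℚ.* (q ℚ.+ 1ℚ)) ≡ ℚ.- cubic q
  factor = solve 1 (λ q →
    con ½ :+ (con ½ :- q) :* (q :* q :+ (q :+ con 1ℚ) :* (q :+ con 1ℚ))
      := :- (con (ι 2) :* (q :* (q :* (q :* con (ι 1)))) :+ q :* (q :* con (ι 1)) :+ (:- con (ι 1)))) refl

-- Here `cubic q` - 2 = (q - 1)(2q² + 3q + 3), and the cofactor is positive for q > 1.
cubic<½⇒≤1 : ∀ q → cubic q ℚ.< ½ → q ℚ.≤ 1ℚ
cubic<½⇒≤1 q f<½ = ℚP.≮⇒≥ λ 1<q → ℚP.<-irrefl refl (ℚP.<-≤-trans f<½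
  (let 0≤q-1 = p≤q⇒0≤q-p (ℚP.<⇒≤ 1<q)
       0≤q   = ℚP.≤-trans (ℚP.nonNegative⁻¹ 1ℚ) (ℚP.<⇒≤ 1<q)
   in ≤-excess (+-nonNeg (*-nonNeg 0≤q-1
        (+-nonNeg (*-nonNeg (ι-nonNeg 2) (square-nonNeg q)) (*-nonNeg (ι-nonNeg 3) (+-nonNeg 0≤q (ι-nonNeg 1)))))
        (ℚP.nonNegative⁻¹ (ι 1 ℚ.+ ½))) (factor q)))
  where
  open ℚSolver
  factor : ∀ q → ½ ℚ.+ ((q ℚ.- 1ℚ) ℚ.* (ι 2 ℚ.* (q ℚ.* q) ℚ.+ ι 3 ℚ.* (q ℚ.+ ι 1)) ℚ.+ (ι 1 ℚ.+ ½)) ≡ cubic q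
  factor = solve 1 (λ q →
    con ½ :+ ((q :- con 1ℚ) :* (con (ι 2) :* (q :* q) :+ con (ι 3) :* (q :+ con (ι 1))) :+ (con (ι 1 ℚ.+ ½)))
    := con (ι 2) :* (q :* (q :* (q :* con (ι 1)))) :+ q :* (q :* con (ι 1)) :+ (:- con (ι 1))) refl

-- Since q · bound q = digitWeight q + cubic q.
digitWeight≤ : ∀ {q η} → 0ℚ ℚ.≤ η → ½ ℚ.≤ q → ℚ.- cubic q ℚ.≤ η →
  digitWeight q ℚ.+ η ℚ.≤ q ℚ.* (bound q ℚ.+ ι 4 ℚ.* η)
digitWeight≤ {q} {η} 0≤η ½≤q -f≤η = ≤-excess
  (+-nonNeg (p≤q⇒0≤q-p -f≤η) (*-nonNeg (ι-nonNeg 4) (*-nonNeg (p≤q⇒0≤q-p ½≤q) 0≤η))) (identity q η)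
  where
  open ℚSolver
  identity : ∀ q η → digitWeight q ℚ.+ η ℚ.+ ((η ℚ.- (ℚ.- cubic q)) ℚ.+ ι 4 ℚ.* ((q ℚ.- ½) ℚ.* η))
    ≡ q ℚ.* (bound q ℚ.+ ι 4 ℚ.* η)
  identity = solve 2 (λ q η →
    con 1ℚ :+ q :+ q :* q :+ q :* q :* q :+ η :+ ((η :-
      (:- (con (ι 2) :* (q :* (q :* (q :* con (ι 1)))) :+ q :* (q :* con (ι 1)) :+ (:- con (ι 1)))))
      :+ con (ι 4) :* ((q :- con ½) :* η))
    := q :* (con (ι 1) :+ con (ι 2) :* q :+ con (ι 3) :* (q :* (q :* con (ι 1))) :+ con (ι 4) :* η)) refl

quotient-≥ : ∀ {r} a b → r ℚ.≤ quotient a b → r ℚ.* ι b ℚ.≤ ι a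
quotient-≥ {r} a zero    _   = ℚP.≤-trans (ℚP.≤-reflexive (ℚP.*-zeroʳ r)) (ι-nonNeg a)
quotient-≥ {r} a (suc b) r≤ =
  ℚP.≤-trans (*-monoʳ-≤ (ι (suc b)) (ι-nonNeg (suc b)) r≤) (ℚP.≤-reflexive (/-*-ι a b))

quotient-pos⇒pos : ∀ a b → 0ℚ ℚ.< quotient a b → 0ℚ ℚ.< ι b
quotient-pos⇒pos a zero    0<0 = contradiction 0<0 (ℚP.<-irrefl refl)
quotient-pos⇒pos a (suc b) _   = ι-suc-pos b

∣x-y∣<c⇒y≤x+c : ∀ {x y c} → ℚ.∣ x ℚ.- y ∣ ℚ.< c → y ℚ.≤ x ℚ.+ c
∣x-y∣<c⇒y≤x+c {x} {y} {c} lt = ≤-excess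
  (p≤q⇒0≤q-p (ℚP.≤-trans (-p≤∣p∣ (x ℚ.- y)) (ℚP.<⇒≤ lt))) (identity x y c)
  where
  open ℚSolver
  identity : ∀ x y c → y ℚ.+ (c ℚ.- (ℚ.- (x ℚ.- y))) ≡ x ℚ.+ c
  identity = solve 3 (λ x y c → y :+ (c :- (:- (x :- y))) := x :+ c) refl

module _ (T : ℕ → ℕ) (card : ∀ n → 1 ℕ.≤ n → HasCardinality (Polyiamonds n) (T n)) where

  -- Otherwise T(n) qⁿ would eventually grow by a factor of at least `H + η` at each step, although
  -- it is bounded by a multiple of `H ^ᵠ n`. As `q ≥ ½`, the margin 4η in the ratio leaves at least
  -- 2η after multiplication by `q`: one η absorbs -`cubic q`, the other is the surplus growth.
  ratios-not-larger : ∀ {q η} N → 1 ℕ.≤ N → ½ ℚ.≤ q → q ℚ.≤ 1ℚ → 0ℚ ℚ.< η → ℚ.- cubic q ℚ.≤ η →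
    ¬ (∀ n → N ℕ.≤ n → bound q ℚ.+ ι 4 ℚ.* η ℚ.≤ quotient (T (suc n)) (T n))
  ratios-not-larger {q} {η} N 1≤N ½≤q q≤1 0<η -f≤η large =
    faster-growth-unbounded {C = H ^ᵠ (12 ℕ.+ N)} s 0<H 0<η 0<s₀ grows bounded
    where
    open ℚP.≤-Reasoning
    0<q : 0ℚ ℚ.< q
    0<q = ℚP.<-≤-trans (ℚP.positive⁻¹ ½) ½≤q
    0≤q = ℚP.<⇒≤ 0<q
    H = digitWeight q
    0<H : 0ℚ ℚ.< H
    0<H = ℚP.+-mono-<-≤ (ℚP.+-mono-<-≤ (ℚP.+-mono-< (ℚP.positive⁻¹ 1ℚ) 0<q) (square-nonNeg q))
      (*-nonNeg (square-nonNeg q) 0≤q)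
    s : ℕ → ℚ
    s k = ι (T (k ℕ.+ N)) ℚ.* q ^ᵠ (6 ℕ.+ (k ℕ.+ N))
    0<ratio : 0ℚ ℚ.< bound q ℚ.+ ι 4 ℚ.* η
    0<ratio = ℚP.+-mono-≤-<
      (+-nonNeg (+-nonNeg (ι-nonNeg 1) (*-nonNeg (ι-nonNeg 2) 0≤q))
        (*-nonNeg (ι-nonNeg 3) (*-nonNeg 0≤q (*-nonNeg 0≤q (ι-nonNeg 1)))))
      (*-pos (ι-suc-pos 3) 0<η)
    -- `T N` is nonzero because the quotient at `N` is positive, whereas division by zero gives 0.
    0<s₀ : 0ℚ ℚ.< s 0
    0<s₀ = *-pos (quotient-pos⇒pos (T (suc N)) (T N) (ℚP.<-≤-trans 0<ratio (large N ℕP.≤-refl)))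
      (^-pos 0<q (6 ℕ.+ N))
    swap : ∀ a b c → a ℚ.* b ℚ.* c ≡ b ℚ.* (a ℚ.* c)
    swap = solve 3 (λ a b c → a :* b :* c := b :* (a :* c)) refl
      where open ℚSolver
    grows : ∀ k → (H ℚ.+ η) ℚ.* s k ℚ.≤ s (suc k)
    grows k = begin
      (H ℚ.+ η) ℚ.* (t ℚ.* qᵉ)
        ≡⟨ sym (ℚP.*-assoc (H ℚ.+ η) t qᵉ) ⟩
      (H ℚ.+ η) ℚ.* t ℚ.* qᵉ
        ≤⟨ *-monoʳ-≤ qᵉ 0≤qᵉ (*-monoʳ-≤ t (ι-nonNeg (T (k ℕ.+ N))) (digitWeight≤ (ℚP.<⇒≤ 0<η) ½≤q -f≤η)) ⟩
      q ℚ.* (bound q ℚ.+ ι 4 ℚ.* η) ℚ.* t ℚ.* qᵉ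
        ≡⟨ cong (ℚ._* qᵉ) (ℚP.*-assoc q (bound q ℚ.+ ι 4 ℚ.* η) t) ⟩
      q ℚ.* ((bound q ℚ.+ ι 4 ℚ.* η) ℚ.* t) ℚ.* qᵉ
        ≤⟨ *-monoʳ-≤ qᵉ 0≤qᵉ (*-monoˡ-≤ q 0≤q
             (quotient-≥ (T (suc (k ℕ.+ N))) (T (k ℕ.+ N)) (large (k ℕ.+ N) (ℕP.m≤n+m N k)))) ⟩
      q ℚ.* t′ ℚ.* qᵉ
        ≡⟨ swap q t′ qᵉ ⟩
      t′ ℚ.* (q ℚ.* qᵉ) ∎
      where
      t  = ι (T (k ℕ.+ N))
      t′ = ι (T (suc (k ℕ.+ N)))
      qᵉ = q ^ᵠ (6 ℕ.+ (k ℕ.+ N))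
      0≤qᵉ = ^-nonNeg 0≤q (6 ℕ.+ (k ℕ.+ N))
    bounded : ∀ k → s k ℚ.≤ H ^ᵠ (12 ℕ.+ N) ℚ.* H ^ᵠ k
    bounded k = begin
      s k                             ≤⟨ polyiamonds-bound (card (k ℕ.+ N) (ℕP.≤-trans 1≤N (ℕP.m≤n+m N k))) 0≤q q≤1 ⟩
      H ^ᵠ (12 ℕ.+ (k ℕ.+ N))         ≡⟨ cong (λ j → H ^ᵠ (12 ℕ.+ j)) (ℕP.+-comm k N) ⟩
      H ^ᵠ (12 ℕ.+ N ℕ.+ k)           ≡⟨ ^-homo-* H (12 ℕ.+ N) k ⟩
      H ^ᵠ (12 ℕ.+ N) ℚ.* H ^ᵠ k      ∎

⅛ : ℚ
⅛ = + 1 ℚ./ 8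

theorem1 : (T : ℕ → ℕ) → (∀ n → 1 ℕ.≤ n → HasCardinality (Polyiamonds n) (T n)) →
    (λT : ℝ) → ConvergesTo (λ n → fromℚ (quotient (T (suc n)) (T n))) λT →
    (z : ℝ) → fromℕ 2 * z ^ 3 + z ^ 2 - fromℕ 1 ≃ fromℕ 0 →
    λT ≤ fromℕ 1 + fromℕ 2 * z + fromℕ 3 * z ^ 2
-- The order of the rationals is decidable, so each inequality may be proved by contradiction.
theorem1 T card λT conv z root ε 0<ε = N , λ k k≥N → decidable-stable (seq λT k ℚP.<? bound (seq z k) ℚ.+ ε)
  λ ≮bound → below k k≥N (ℚP.≮⇒≥ ≮bound)
  where
  -- ε is spent as 4η + 2η + 2η: the margin in `ratios-not-larger`, the passage between two terms of
  -- `λT`, and the distance from a ratio to `λT`.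
  η = ⅛ ℚ.* ε
  0<η : 0ℚ ℚ.< η
  0<η = *-pos (ℚP.positive⁻¹ ⅛) 0<ε
  0<2η : 0ℚ ℚ.< ι 2 ℚ.* η
  0<2η = *-pos (ι-suc-pos 1) 0<η
  root-η = root η 0<η
  root-½ = root ½ (ℚP.positive⁻¹ ½)
  cauchy-2η = cauchy λT (ι 2 ℚ.* η) 0<2η
  conv-2η = conv (ι 2 ℚ.* η) 0<2η
  N₁ = proj₁ root-η
  N₂ = proj₁ root-½
  N₃ = proj₁ cauchy-2η
  N = N₁ ℕ.⊔ N₂ ℕ.⊔ N₃
  -- At least 1, because the counts are given only from n = 1 on.
  M = 1 ℕ.⊔ proj₁ conv-2η

  cancel : ∀ b a e → b ℚ.+ ι 4 ℚ.* (⅛ ℚ.* e) ℚ.+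
    (a ℚ.+ ι 2 ℚ.* (⅛ ℚ.* e) ℚ.+ ι 2 ℚ.* (⅛ ℚ.* e) ℚ.- (b ℚ.+ e)) ≡ a
  cancel = solve 3 (λ b a e → b :+ con (ι 4) :* (con ⅛ :* e) :+
    (a :+ con (ι 2) :* (con ⅛ :* e) :+ con (ι 2) :* (con ⅛ :* e) :- (b :+ e)) := a) refl
    where open ℚSolver

  minus-zero : ∀ p → p ℚ.- ι 0 ≡ p
  minus-zero p = ℚP.+-identityʳ p

  below : ∀ k → N ℕ.≤ k → ¬ (bound (seq z k) ℚ.+ ε ℚ.≤ seq λT k)
  below k k≥N b+ε≤λ = ratios-not-larger T card M (ℕP.m≤m⊔n 1 (proj₁ conv-2η))
    (-cubic<½⇒½≤ q -f<½) (cubic<½⇒≤1 q f<½) 0<η -f≤η large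
    where
    -- A single rational approximation of `z` suffices: `cubic q` is merely small, and η absorbs the
    -- error.
    q = seq z k
    k≥N₁₂ = ℕP.m⊔n≤o⇒m≤o (N₁ ℕ.⊔ N₂) N₃ k≥N
    ∣f∣<η : ℚ.∣ cubic q ∣ ℚ.< η
    ∣f∣<η = subst (λ p → ℚ.∣ p ∣ ℚ.< η) (minus-zero (cubic q)) (proj₂ root-η k (ℕP.m⊔n≤o⇒m≤o N₁ N₂ k≥N₁₂))
    ∣f∣<½ : ℚ.∣ cubic q ∣ ℚ.< ½
    ∣f∣<½ = subst (λ p → ℚ.∣ p ∣ ℚ.< ½) (minus-zero (cubic q)) (proj₂ root-½ k (ℕP.m⊔n≤o⇒n≤o N₁ N₂ k≥N₁₂))
    -f≤η : ℚ.- cubic q ℚ.≤ η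
    -f≤η = ℚP.≤-trans (-p≤∣p∣ (cubic q)) (ℚP.<⇒≤ ∣f∣<η)
    f<½ : cubic q ℚ.< ½
    f<½ = ℚP.≤-<-trans (p≤∣p∣ (cubic q)) ∣f∣<½
    -f<½ : ℚ.- cubic q ℚ.< ½
    -f<½ = ℚP.≤-<-trans (-p≤∣p∣ (cubic q)) ∣f∣<½

    large : ∀ n → M ℕ.≤ n → bound q ℚ.+ ι 4 ℚ.* η ℚ.≤ quotient (T (suc n)) (T n)
    large n n≥M = ≤-excess (p≤q⇒0≤q-p b+ε≤a+4η) (cancel (bound q) a ε)
      where
      a = quotient (T (suc n)) (T n)
      near = proj₂ conv-2η n (ℕP.m⊔n≤o⇒n≤o 1 (proj₁ conv-2η) n≥M)
      -- An index late enough both for the Cauchy estimate of `λT` and for the termwise form of the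
      -- real inequality `near`, whose threshold depends on `n`.
      j = N₃ ℕ.⊔ proj₁ (proj₂ (proj₂ near))
      ∣a-λⱼ∣<2η : ℚ.∣ a ℚ.- seq λT j ∣ ℚ.< ι 2 ℚ.* η
      ∣a-λⱼ∣<2η = ℚP.≤-<-trans
        (≤-excess (ℚP.<⇒≤ (proj₁ (proj₂ near))) refl)
        (proj₂ (proj₂ (proj₂ near)) j (ℕP.m≤n⊔m N₃ (proj₁ (proj₂ (proj₂ near)))))
      b+ε≤a+4η : bound q ℚ.+ ε ℚ.≤ a ℚ.+ ι 2 ℚ.* η ℚ.+ ι 2 ℚ.* η
      b+ε≤a+4η = begin
        bound q ℚ.+ ε                       ≤⟨ b+ε≤λ ⟩
        seq λT k                            ≤⟨ ∣x-y∣<c⇒y≤x+c {seq λT j} {seq λT k} (proj₂ cauchy-2η j k (ℕP.m≤m⊔n N₃ (proj₁ (proj₂ (proj₂ near)))) (ℕP.m⊔n≤o⇒n≤o (N₁ ℕ.⊔ N₂) N₃ k≥N)) ⟩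
        seq λT j ℚ.+ ι 2 ℚ.* η              ≤⟨ ℚP.+-monoˡ-≤ (ι 2 ℚ.* η) (∣x-y∣<c⇒y≤x+c {a} {seq λT j} ∣a-λⱼ∣<2η) ⟩
        a ℚ.+ ι 2 ℚ.* η ℚ.+ ι 2 ℚ.* η       ∎
        where open ℚP.≤-Reasoning
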